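{- Tropical elliptic curves from regular unimodular triangulations of the Cayley polytope $C(2\Delta_3,2\Delta_3)$ achieve all possible cycle lengths (between $3$ and $16$): for every integer $n$ with $3\le n\le 16$ there exists a regular unimodular triangulation $T$ of $C(2\Delta_3,2\Delta_3)$ such that the unique cycle of the associated tropical elliptic curve $G(T)$ has length $n$.
   Context: Let $\mathbf{e}_1,\mathbf{e}_2,\mathbf{e}_3$ be the standard basis of $\mathbb{R}^3$ and $2\Delta_3 := \mathrm{conv}\{\mathbf{0}, 2\mathbf{e}_1, 2\mathbf{e}_2, 2\mathbf{e}_3\} \subset \mathbb{R}^3$; it contains $10$ lattice points. Writing also $\mathbf{e}_1,\mathbf{e}_2$ for the standard basis of $\mathbb{R}^2$, the Cayley polytope is $$C(2\Delta_3,2\Delta_3) := \mathrm{conv}\big(\{\mathbf{e}_1\}\times 2\Delta_3 \;\cup\; \{\mathbf{e}_2\}\times 2\Delta_3\big) \subset \mathbb{R}^2\times\mathbb{R}^3=\mathbb{R}^5 .$$ It is a $4$-dimensional polytope (isomorphic to $2\Delta_3\times\Delta_1$) with $8$ vertices and $20$ lattice points: $10$ in $\{\mathbf{e}_1\}\times 2\Delta_3$ and $10$ in $\{\mathbf{e}_2\}\times 2\Delta_3$. Triangulations are triangulations of the polytope whose vertices are among its lattice points. A triangulation is regular if it is induced by a height (weight) function on the $20$ lattice points, i.e. its maximal cells are the projections of the lower facets of the convex hull of the lifted points. It is unimodular if every maximal simplex has normalized lattice volume $1$ with respect to the lattice $\mathbb{Z}^5\cap \mathrm{aff}\,C(2\Delta_3,2\Delta_3)$;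 since the polytope has normalized volume $32$, such a triangulation has exactly $32$ maximal simplices. The tropical elliptic curve $G(T)$ of a regular unimodular triangulation $T$: slicing $T$ with $\{x_1=x_2=1/2\}$ (and scaling by $2$) gives a mixed subdivision of the Minkowski sum $2\Delta_3+2\Delta_3=4\Delta_3$ whose maximal cells are $Q_1+Q_2$, where the maximal simplex of $T$ being sliced is $\mathrm{conv}(\{\mathbf{e}_1\}\times Q_1\cup\{\mathbf{e}_2\}\times Q_2)$ and $\dim Q_1+\dim Q_2=3$. A cell is mixed if $\dim Q_1,\dim Q_2>0$; then one of $Q_1,Q_2$ is a segment and the other a triangle, and the cell is a triangular prism. The graph $G(T)$ has one vertex for each mixed cell and one edge for each pair of mixed cells sharing a common quadrilateral facet. Equivalently: the vertices of $G(T)$ are the maximal simplices of $T$ having $2$ or $3$ of their $5$ vertices in $\{\mathbf{e}_1\}\times 2\Delta_3$, and two of them are joined by an edge when they share a common facet having exactly $2$ vertices in each of the two copies of $2\Delta_3$. This is a connected graph of genus $1$ with $16$ vertices and $16$ edges, so it contains a unique cycle; the cycle length is the number of edges of that cycle. (The tropical curve also has $16$ unbounded rays, which are suppressed.)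
   Formalization: The polytope, its simplices and the lifting functions are taken over the rational numbers instead of the reals: covering and proper intersection of the triangulation are stated for rational points, and heights are rational. -}

module Defs where

open import Algebra.Bundles using (CommutativeRing)
import Algebra.Properties.Semiring.Sum as Sum
open import Data.Bool.Base using (if_then_else_)
open import Data.Fin.Base using (Fin; zero; suc; toℕ; punchIn)
open import Data.Fin.Properties using (_≟_)
open import Data.Fin.Subset using (Subset; _∈_; _∉_; _⊆_; _∩_; ∣_∣; ⋃; ⁅_⁆)
open import Data.Integer.Base as ℤ using (ℤ; +_; -1ℤ)
import Data.Integer.Properties as ℤ
open import Data.List.Base as List using (List; []; _∷_; _∷ʳ_; length)
import Data.List.Membership.Propositional as List
open import Data.List.Relation.Unary.All using (All)
open import Data.List.Relation.Unary.Unique.Propositional using (Unique)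
open import Data.Nat.Base as ℕ using (ℕ; zero; suc)
open import Data.Product.Base using (Σ-syntax; ∃-syntax; _×_; _,_; uncurry)
open import Data.Rational.Base as ℚ using (ℚ; 0ℚ; 1ℚ; _+_; _*_; _≤_)
import Data.Rational.Properties as ℚ
open import Data.Sum.Base using (_⊎_)
open import Data.Vec.Base as Vec using (Vec; []; _∷_; lookup)
open import Data.Vec.Functional as Vector using (Vector)
open import Function.Bundles using (_⇔_)
open import Level using (0ℓ)
open import Relation.Binary.Core using (Rel)
open import Relation.Binary.PropositionalEquality using (_≡_; _≗_)
open import Relation.Nullary.Decidable using (does)
open import Relation.Unary using (Pred) renaming (_∪_ to _∪ₚ_)

open Sum (CommutativeRing.semiring ℚ.+-*-commutativeRing) using (sum) public
open Sum ℤ.+-*-semiring using () renaming (sum to sumℤ) public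

-- All polyhedral geometry is done over ℚ: every polytope below is a lattice
-- polytope.  Points are functions, compared pointwise (_≗_).

Point : ℕ → Set
Point d = Vector ℚ d

Region : ℕ → Set₁
Region d = Pred (Point d) 0ℓ

Σ⟨_·_⟩ : ∀ {m d} → Vector ℚ m → Vector (Point d) m → Point d
Σ⟨ c · p ⟩ j = sum (λ i → c i * p i j)

conv : ∀ {d} → Region d → Region d
conv X x =
  Σ[ m ∈ ℕ ] Σ[ c ∈ Vector ℚ m ] Σ[ p ∈ Vector (Point _) m ]
    (∀ i → X (p i)) × (∀ i → 0ℚ ≤ c i) × sum c ≡ 1ℚ × x ≗ Σ⟨ c · p ⟩

range : ∀ {d m} → Vector (Point d) m → Region d
range v x = ∃[ i ] x ≗ v i

𝐞 : ∀ {d} → Fin d → Point d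
𝐞 i j = if does (i ≟ j) then 1ℚ else 0ℚ

2Δ₃ : Region 3
2Δ₃ = conv (range v)
  where
  v : Vector (Point 3) 4
  v zero    _ = 0ℚ
  v (suc i) j = (1ℚ + 1ℚ) * 𝐞 i j

_⊠_ : ∀ {k d} → Point k → Region d → Region (k ℕ.+ d)
(a ⊠ P) x = ∃[ y ] P y × x ≗ (a Vector.++ y)

cayley : ∀ {d} → Region d → Region d → Region (2 ℕ.+ d)
cayley P Q = conv ((𝐞 {2} zero ⊠ P) ∪ₚ (𝐞 {2} (suc zero) ⊠ Q))

C : Region 5
C = cayley 2Δ₃ 2Δ₃

-- The ten lattice points of 2Δ₃, i.e. all (a,b,c) ∈ ℕ³ with a + b + c ≤ 2.

lattice2Δ₃ : Vec (Vec ℤ 3) 10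
lattice2Δ₃ =
    (+ 0 ∷ + 0 ∷ + 0 ∷ [])
  ∷ (+ 1 ∷ + 0 ∷ + 0 ∷ []) ∷ (+ 0 ∷ + 1 ∷ + 0 ∷ []) ∷ (+ 0 ∷ + 0 ∷ + 1 ∷ [])
  ∷ (+ 2 ∷ + 0 ∷ + 0 ∷ []) ∷ (+ 0 ∷ + 2 ∷ + 0 ∷ []) ∷ (+ 0 ∷ + 0 ∷ + 2 ∷ [])
  ∷ (+ 1 ∷ + 1 ∷ + 0 ∷ []) ∷ (+ 1 ∷ + 0 ∷ + 1 ∷ []) ∷ (+ 0 ∷ + 1 ∷ + 1 ∷ [])
  ∷ []

-- The twenty lattice points of C: indices 0–9 lie in {𝐞₁} × 2Δ₃ and
-- indices 10–19 in {𝐞₂} × 2Δ₃.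

latticeC : Vec (Vec ℤ 5) (10 ℕ.+ 10)
latticeC = Vec.map (λ z → + 1 ∷ + 0 ∷ z) lattice2Δ₃
     Vec.++ Vec.map (λ z → + 0 ∷ + 1 ∷ z) lattice2Δ₃

Index : Set
Index = Fin (10 ℕ.+ 10)

pt : Index → Point 5
pt i j = lookup (lookup latticeC i) j ℚ./ 1

-- Cells are recorded by their sets of (indices of) lattice points.

Cell : Set
Cell = Subset (10 ℕ.+ 10)

∥_∥ : Cell → Region 5
∥ σ ∥ = conv (λ x → ∃[ i ] i ∈ σ × x ≗ pt i)

AffinelyIndependent : Cell → Set
AffinelyIndependent σ =
  (c : Vector ℚ _) → (∀ i → i ∉ σ → c i ≡ 0ℚ) →
  sum c ≡ 0ℚ → (∀ j → Σ⟨ c · pt ⟩ j ≡ 0ℚ) → ∀ i → c i ≡ 0ℚ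

IsFullSimplex : Cell → Set
IsFullSimplex σ = ∣ σ ∣ ≡ 5 × AffinelyIndependent σ

-- T lists the maximal simplices.  As the faces of a simplex are the hulls of
-- the subsets of its vertices, ∥ σ ∥ and ∥ τ ∥ meet in a common (possibly
-- empty) face precisely when they meet in ∥ σ ∩ τ ∥.

record IsTriangulation (T : List Cell) : Set where
  field
    simplices : ∀ σ → σ List.∈ T → IsFullSimplex σ
    proper    : ∀ σ τ → σ List.∈ T → τ List.∈ T →
                ∀ x → ∥ σ ∥ x → ∥ τ ∥ x → ∥ σ ∩ τ ∥ x
    covers    : ∀ x → C x → ∃[ σ ] σ List.∈ T × ∥ σ ∥ x

-- F labels a lower face of the lifted points (pt i , w i): these lie on or
-- above the graph of x ↦ ⟨u , x⟩ + b, and on it exactly for i ∈ F.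

IsLowerFace : Vector ℚ (10 ℕ.+ 10) → Cell → Set
IsLowerFace w F = Σ[ u ∈ Point 5 ] Σ[ b ∈ ℚ ]
  let h = λ i → sum (λ j → u j * pt i j) + b in
  (∀ i → h i ≤ w i) × (∀ i → i ∈ F ⇔ h i ≡ w i)

-- A lower facet is a lower face of dimension 4 = dim C.

IsLowerFacet : Vector ℚ (10 ℕ.+ 10) → Cell → Set
IsLowerFacet w F = IsLowerFace w F × ∃[ σ ] σ ⊆ F × IsFullSimplex σ

IsRegular : List Cell → Set
IsRegular T = ∃[ w ] (∀ F → F List.∈ T ⇔ IsLowerFacet w F)

det : ∀ {n} → Vector (Vector ℤ n) n → ℤ
det {zero}  _ = + 1
det {suc n} M = sumℤ λ j →
  (-1ℤ ℤ.^ toℕ j) ℤ.* M zero j ℤ.* det (λ i k → M (suc i) (punchIn j k))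

-- aff C is {x₁ + x₂ = 1}, so forgetting x₁ maps ℤ⁵ ∩ aff C isomorphically onto
-- ℤ⁴.  Hence the normalized volume of a simplex is the absolute value of the
-- determinant of its edge vectors at one vertex, in the coordinates x₂,…,x₅.

normalizedVolume : Vec Index 5 → ℕ
normalizedVolume v = ℤ.∣ det edges ∣
  where
  coord : Fin 5 → Fin 4 → ℤ
  coord i k = lookup (lookup latticeC (lookup v i)) (suc k)
  edges : Vector (Vector ℤ 4) 4
  edges i k = coord (suc i) k ℤ.- coord zero k

-- The order in which v enumerates the vertices of σ does not matter.

UnimodularSimplex : Cell → Set
UnimodularSimplex σ =
  ∃[ v ] σ ≡ ⋃ (List.map ⁅_⁆ (Vec.toList v)) × normalizedVolume v ≡ 1

IsUnimodular : List Cell → Set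
IsUnimodular T = ∀ σ → σ List.∈ T → UnimodularSimplex σ

record Graph (A : Set) : Set₁ where
  field
    Vertex : Pred A 0ℓ
    Edge   : Rel A 0ℓ

-- A maximal simplex σ is sliced in the Minkowski cell Q₁ σ + Q₂ σ.

Q₁ Q₂ : Cell → Subset 10
Q₁ σ = Vec.take 10 σ
Q₂ σ = Vec.drop 10 σ

-- The Qᵢ of a simplex are simplices, so dim Qᵢ > 0 means ∣ Qᵢ ∣ ≥ 2.

IsMixed : Cell → Set
IsMixed σ = 2 ℕ.≤ ∣ Q₁ σ ∣ × 2 ℕ.≤ ∣ Q₂ σ ∣

-- A common quadrilateral facet of two mixed cells is a sum of two segments,
-- i.e. it comes from a common facet of the two simplices having exactly two
-- vertices in either copy of 2Δ₃.  (This forces σ ≢ τ, since ∣ σ ∣ ≡ 5.)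

G : List Cell → Graph Cell
G T = record { Vertex = V ; Edge = λ σ τ → V σ × V τ × ShareQuad σ τ }
  where
  V : Pred Cell 0ℓ
  V σ = σ List.∈ T × IsMixed σ
  ShareQuad : Rel Cell 0ℓ
  ShareQuad σ τ = ∣ Q₁ (σ ∩ τ) ∣ ≡ 2 × ∣ Q₂ (σ ∩ τ) ∣ ≡ 2

-- A cycle is given by its vertices in cyclic order; steps lists its edges,
-- including the one from the last vertex back to the first.

steps : ∀ {A : Set} → List A → List (A × A)
steps []       = []
steps (v ∷ vs) = List.zip (v ∷ vs) (vs ∷ʳ v)

module _ {A : Set} (Γ : Graph A) where
  open Graph Γ

  IsCycle : List A → Set
  IsCycle c = 3 ℕ.≤ length c × Unique c × All (uncurry Edge) (steps c)

  OnCycle : List A → Rel A 0ℓ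
  OnCycle c u v = (u , v) List.∈ steps c ⊎ (v , u) List.∈ steps c

  -- Cycles are identified up to starting point and orientation.

  UniqueCycleHasLength : ℕ → Set
  UniqueCycleHasLength n =
    ∃[ c ] IsCycle c × length c ≡ n ×
      (∀ c′ → IsCycle c′ → ∀ u v → OnCycle c′ u v ⇔ OnCycle c u v)

{-# OPTIONS --safe #-}
module Submission where

-- For each length we exhibit integer heights on the twenty lattice points together with the
-- list of maximal simplices of the induced subdivision, and verify a finite certificate: the
-- barycentric coordinates of every simplex are integral, the affine function through its
-- lifted vertices lies strictly below all other lifted points, and each of its facets lies in
-- the boundary of C or separates it from another listed simplex.
--
-- The certificate determines the subdivision.  If x ∈ C and σ maximises the height at x of the
-- affine function of σ, then x ∈ σ: were a barycentric coordinate negative, the simplex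
-- across the opposite facet would have a larger value at x.  Two simplices containing x both
-- attain the maximum, so x is a combination of points where both affine functions touch the
-- lifted points, i.e. of common vertices.  Applied to the barycentre of a full simplex in an
-- arbitrary lower facet F, the same comparison shows that F is one of the listed simplices.
--
-- The cycle of G(T) is unique because the vertices off the given cycle can be deleted one by
-- one, each having at most one neighbour left, and the given cycle has no chords.

open import Defs
open import Data.Nat.Base using (ℕ; _≤_)
open import Data.Product.Base using (∃-syntax; _×_)

open import Algebra.Bundles using (CommutativeRing)
import Algebra.Properties.Semiring.Sum as Summation
open import Data.Bool.Base using (if_then_else_; true; false)
import Data.Bool.Properties as Bool
open import Data.Fin.Base as Fin using (Fin; zero; suc; toℕ; fromℕ<)
open import Data.Fin using (#_)
open import Data.Fin.Patterns using (0F; 1F; 2F; 3F)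
import Data.Fin.Properties as Fin
open import Data.Fin.Subset using (Subset; inside; outside; _∈_; _∉_; _⊆_; _∩_; ∣_∣; ⋃; ⁅_⁆)
open import Data.Fin.Subset.Properties as Subset using (_∈?_)
open import Data.Integer.Base as ℤ using (ℤ; 0ℤ; 1ℤ)
import Data.Integer.Properties as ℤ
open import Data.List.Base as List using (List; []; _∷_; _∷ʳ_; _++_; length; filter; zip; initLast; _∷ʳ′_)
import Data.List.Membership.Propositional as List
open import Data.List.Membership.Propositional using (find)
open import Data.List.Membership.Propositional.Properties
  using (∈-filter⁺; ∈-map⁺; ∈-map⁻; ∈-++⁺ʳ; ∈-++⁻; ∈-∃++)
import Data.List.Properties as List
open import Data.List.Relation.Binary.Permutation.Propositional using (_↭_; ↭⇒↭ₛ)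
open import Data.List.Relation.Binary.Permutation.Propositional.Properties using (++-comm; ↭-length)
import Data.List.Relation.Binary.Permutation.Setoid.Properties as Permutation
open import Data.List.Relation.Unary.All as All using (All)
import Data.List.Relation.Unary.All.Properties as All
open import Data.List.Relation.Unary.AllPairs using (_∷_)
open import Data.List.Relation.Unary.Any as Any using (Any; here; there)
open import Data.List.Relation.Unary.Unique.Propositional using (Unique)
open import Data.Nat.Base as ℕ using (zero; suc; s≤s)
open import Data.Nat.DivMod using (_mod_)
import Data.Nat.Properties as ℕ
open import Data.Product.Base using (Σ-syntax; _,_; proj₁; proj₂; uncurry)
open import Data.Rational.Base as ℚ using (ℚ; 0ℚ; 1ℚ; _+_; _*_; _<_)
import Data.Rational.Properties as ℚ
open import Data.Rational.Unnormalised.Base as ℚᵘ using (mkℚᵘ)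
import Data.Rational.Unnormalised.Properties as ℚᵘ
open import Data.Sum.Base as Sum using (_⊎_; inj₁; inj₂; [_,_]′)
open import Data.Unit.Base using (⊤; tt)
open import Data.Vec.Base as Vec using (Vec; []; _∷_; lookup)
open import Data.Vec.Functional as Vector using (Vector)
import Data.Vec.Properties as Vec
open import Function.Base using (_∘_; _$_; id; case_of_)
open import Function.Bundles using (_⇔_; mk⇔; Equivalence)
open import Level using (0ℓ)
open import Relation.Binary.Bundles using (DecTotalOrder)
open import Relation.Binary.Core using (Rel)
open import Relation.Binary.Definitions using (Decidable; Symmetric)
open import Relation.Binary.PropositionalEquality
open import Relation.Nullary
  using (¬_; Dec; yes; no; contradiction; does; ¬?; _×-dec_; _⊎-dec_; _→-dec_)

open import Data.List.Relation.Unary.Unique.DecPropositional (Vec.≡-dec {n = 20} Bool._≟_) using (unique?)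
import Data.List.Extrema (DecTotalOrder.totalOrder ℚ.≤-decTotalOrder) as Extrema

private
  module Σℚ = Summation (CommutativeRing.semiring ℚ.+-*-commutativeRing)

-- Linear functionals and convex combinations

⟨_,_⟩ : ∀ {d} → Vector ℚ d → Point d → ℚ
⟨ u , x ⟩ = sum (λ j → u j * x j)

sum-cong : ∀ {n} {f g : Vector ℚ n} → f ≗ g → sum f ≡ sum g
sum-cong = Σℚ.sum-cong-≗

⟨⟩-congʳ : ∀ {d} (u : Vector ℚ d) {x y : Point d} → x ≗ y → ⟨ u , x ⟩ ≡ ⟨ u , y ⟩
⟨⟩-congʳ u x≗y = sum-cong (λ j → cong (u j *_) (x≗y j))

⟨⟩-combination : ∀ {d m} (u : Vector ℚ d) (c : Vector ℚ m) (p : Vector (Point d) m) →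
                 ⟨ u , Σ⟨ c · p ⟩ ⟩ ≡ sum (λ i → c i * ⟨ u , p i ⟩)
⟨⟩-combination u c p = begin
  sum (λ j → u j * sum (λ i → c i * p i j))   ≡⟨ sum-cong (λ j → Σℚ.*-distribˡ-sum (u j) (λ i → c i * p i j)) ⟩
  sum (λ j → sum (λ i → u j * (c i * p i j))) ≡⟨ Σℚ.∑-comm (λ j i → u j * (c i * p i j)) ⟩
  sum (λ i → sum (λ j → u j * (c i * p i j))) ≡⟨ sum-cong (λ i → sum-cong (λ j → swap (u j) (c i) (p i j))) ⟩
  sum (λ i → sum (λ j → c i * (u j * p i j))) ≡⟨ sum-cong (λ i → Σℚ.*-distribˡ-sum (c i) (λ j → u j * p i j)) ⟨
  sum (λ i → c i * ⟨ u , p i ⟩)               ∎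
  where
  open ≡-Reasoning
  swap : ∀ a b c → a * (b * c) ≡ b * (a * c)
  swap a b c = trans (sym (ℚ.*-assoc a b c)) (trans (cong (_* c) (ℚ.*-comm a b)) (ℚ.*-assoc b a c))

sum-≡0 : ∀ {n} {f : Vector ℚ n} → (∀ i → f i ≡ 0ℚ) → sum f ≡ 0ℚ
sum-≡0 {n} f≡0 = trans (sum-cong f≡0) (Σℚ.sum-replicate-zero n)

sum-single : ∀ {n} {f : Vector ℚ n} k → (∀ i → i ≢ k → f i ≡ 0ℚ) → sum f ≡ f k
sum-single {f = f} zero    f≡0 = trans (cong (f zero +_) (sum-≡0 (λ i → f≡0 (suc i) λ ()))) (ℚ.+-identityʳ _)
sum-single (suc k) f≡0 = trans
  (cong₂ _+_ (f≡0 zero λ ()) (sum-single k (λ i i≢k → f≡0 (suc i) (i≢k ∘ Fin.suc-injective))))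
  (ℚ.+-identityˡ _)

sum-mono-≤ : ∀ {n} {f g : Vector ℚ n} → (∀ i → f i ℚ.≤ g i) → sum f ℚ.≤ sum g
sum-mono-≤ {zero}  f≤g = ℚ.≤-refl
sum-mono-≤ {suc n} f≤g = ℚ.+-mono-≤ (f≤g zero) (sum-mono-≤ (f≤g ∘ suc))

sum-mono-< : ∀ {n} {f g : Vector ℚ n} → (∀ i → f i ℚ.≤ g i) → ∀ k → f k < g k → sum f < sum g
sum-mono-< f≤g zero    fk<gk = ℚ.+-mono-<-≤ fk<gk (sum-mono-≤ (f≤g ∘ suc))
sum-mono-< f≤g (suc k) fk<gk = ℚ.+-mono-≤-< (f≤g zero) (sum-mono-< (f≤g ∘ suc) k fk<gk)

*-monoˡ-≤ : ∀ {c a b} → 0ℚ ℚ.≤ c → a ℚ.≤ b → c * a ℚ.≤ c * b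
*-monoˡ-≤ {c} 0≤c = ℚ.*-monoˡ-≤-nonNeg c {{ℚ.nonNegative 0≤c}}

*-monoʳ-< : ∀ {c a b} → 0ℚ < c → a < b → c * a < c * b
*-monoʳ-< {c} 0<c = ℚ.*-monoʳ-<-pos c {{ℚ.positive 0<c}}

combination-mono : ∀ {m} {c a b : Vector ℚ m} → (∀ i → 0ℚ ℚ.≤ c i) → (∀ i → a i ℚ.≤ b i) →
                   sum (λ i → c i * a i) ℚ.≤ sum (λ i → c i * b i)
combination-mono 0≤c a≤b = sum-mono-≤ (λ i → *-monoˡ-≤ (0≤c i) (a≤b i))

≤∧≢⇒< : ∀ {p q} → p ℚ.≤ q → p ≢ q → p < q
≤∧≢⇒< p≤q p≢q = ℚ.≰⇒> (λ q≤p → p≢q (ℚ.≤-antisym p≤q q≤p))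

-- Complementary slackness: a strict inequality at one index of nonzero weight would make the
-- weighted sum of `a` strictly smaller than that of `b`.
combination-tight : ∀ {m} {c a b : Vector ℚ m} → (∀ i → 0ℚ ℚ.≤ c i) → (∀ i → a i ℚ.≤ b i) →
                    sum (λ i → c i * b i) ℚ.≤ sum (λ i → c i * a i) →
                    ∀ i → c i ≢ 0ℚ → a i ≡ b i
combination-tight {a = a} {b} 0≤c a≤b Σb≤Σa i cᵢ≢0 with a i ℚ.≟ b i
... | yes aᵢ≡bᵢ = aᵢ≡bᵢ
... | no  aᵢ≢bᵢ = contradiction refl (ℚ.<⇒≢ (ℚ.<-≤-trans Σa<Σb Σb≤Σa))
  where
  Σa<Σb = sum-mono-< (λ i → *-monoˡ-≤ (0≤c i) (a≤b i)) i
    (*-monoʳ-< (≤∧≢⇒< (0≤c i) (cᵢ≢0 ∘ sym)) (≤∧≢⇒< (a≤b i) aᵢ≢bᵢ))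

combination-nonneg : ∀ {m} {c f : Vector ℚ m} → (∀ i → 0ℚ ℚ.≤ c i) → (∀ i → 0ℚ ℚ.≤ f i) →
                     0ℚ ℚ.≤ sum (λ i → c i * f i)
combination-nonneg {c = c} 0≤c 0≤f = ℚ.≤-trans
  (ℚ.≤-reflexive (sym (sum-≡0 (λ i → ℚ.*-zeroʳ (c i)))))
  (combination-mono 0≤c 0≤f)

affine-combination : ∀ {d m} (u : Vector ℚ d) b (c : Vector ℚ m) (p : Vector (Point d) m) →
                     sum c ≡ 1ℚ →
                     ⟨ u , Σ⟨ c · p ⟩ ⟩ + b ≡ sum (λ i → c i * (⟨ u , p i ⟩ + b))
affine-combination u b c p Σc≡1 = begin
  ⟨ u , Σ⟨ c · p ⟩ ⟩ + b                                 ≡⟨ cong₂ _+_ (⟨⟩-combination u c p) b≡Σ ⟩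
  sum (λ i → c i * ⟨ u , p i ⟩) + sum (λ i → c i * b)    ≡⟨ Σℚ.∑-distrib-+ _ (λ i → c i * b) ⟨
  sum (λ i → c i * ⟨ u , p i ⟩ + c i * b)                ≡⟨ sum-cong (λ i → ℚ.*-distribˡ-+ (c i) _ b) ⟨
  sum (λ i → c i * (⟨ u , p i ⟩ + b))                    ∎
  where
  open ≡-Reasoning
  b≡Σ : b ≡ sum (λ i → c i * b)
  b≡Σ = trans (sym (trans (cong (_* b) Σc≡1) (ℚ.*-identityˡ b))) (Σℚ.*-distribʳ-sum b c)

conv-linear : ∀ {d} {X : Region d} (u : Vector ℚ d) → (∀ x → X x → 0ℚ ℚ.≤ ⟨ u , x ⟩) →
              ∀ x → conv X x → 0ℚ ℚ.≤ ⟨ u , x ⟩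
conv-linear u X≥0 x (m , c , p , X-p , 0≤c , _ , x≗) =
  subst (0ℚ ℚ.≤_) (sym (trans (⟨⟩-congʳ u x≗) (⟨⟩-combination u c p)))
    (combination-nonneg 0≤c (λ i → X≥0 (p i) (X-p i)))

-- `conv` asks every listed point to lie in `X`, even a point of weight zero. Passing to the
-- support, enumerated by `e`, removes such points and keeps all weighted sums.
drop-zeros : ∀ {m} (c : Vector ℚ m) → ∃[ k ] Σ[ e ∈ (Fin k → Fin m) ]
        (∀ i → c (e i) ≢ 0ℚ) ×
        (∀ (f : Vector ℚ m) → sum (λ i → c (e i) * f (e i)) ≡ sum (λ i → c i * f i))
drop-zeros {zero}  c = zero , (λ ()) , (λ ()) , λ f → refl
drop-zeros {suc m} c with c zero ℚ.≟ 0ℚ | drop-zeros (c ∘ suc)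
... | yes c₀≡0 | k , e , e≢0 , Σ≡ = k , suc ∘ e , e≢0 , λ f →
  let rest = sum (λ i → c (suc i) * f (suc i)) in begin
  sum (λ i → c (suc (e i)) * f (suc (e i))) ≡⟨ Σ≡ (f ∘ suc) ⟩
  rest                                      ≡⟨ ℚ.+-identityˡ rest ⟨
  0ℚ + rest                                 ≡⟨ cong (_+ rest) (ℚ.*-zeroˡ (f zero)) ⟨
  0ℚ * f zero + rest                        ≡⟨ cong (λ a → a * f zero + rest) c₀≡0 ⟨
  c zero * f zero + rest                    ∎
  where open ≡-Reasoning
... | no c₀≢0 | k , e , e≢0 , Σ≡ = suc k , e′ , e′≢0 , λ f → cong (c zero * f zero +_) (Σ≡ (f ∘ suc))
  where
  e′ : Fin (suc k) → Fin (suc m)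
  e′ zero    = zero
  e′ (suc i) = suc (e i)
  e′≢0 : ∀ i → c (e′ i) ≢ 0ℚ
  e′≢0 zero    = c₀≢0
  e′≢0 (suc i) = e≢0 i

conv-support : ∀ {d m} {X : Region d} (c : Vector ℚ m) (p : Vector (Point d) m) →
               (∀ i → c i ≢ 0ℚ → X (p i)) → (∀ i → 0ℚ ℚ.≤ c i) → sum c ≡ 1ℚ →
               ∀ {x} → x ≗ Σ⟨ c · p ⟩ → conv X x
conv-support c p X-p 0≤c Σc≡1 x≗ with k , e , e≢0 , Σ≡ ← drop-zeros c =
  k , c ∘ e , p ∘ e , (λ i → X-p (e i) (e≢0 i)) , 0≤c ∘ e ,
  -- Taking `f` constantly 1 shows that the remaining weights still sum to 1.
  trans (sum-cong (λ i → sym (ℚ.*-identityʳ (c (e i)))))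
    (trans (Σ≡ (λ _ → 1ℚ)) (trans (sum-cong (λ i → ℚ.*-identityʳ (c i))) Σc≡1)) ,
  λ j → trans (x≗ j) (sym (Σ≡ (λ i → p i j)))

-- Written as in `pt`, so that the coordinates of `pt i` are values of `fromℤ` by definition.
fromℤ : ℤ → ℚ
fromℤ z = z ℚ./ 1

toℚᵘ-fromℤ : ∀ z → ℚ.toℚᵘ (fromℤ z) ℚᵘ.≃ mkℚᵘ z 0
toℚᵘ-fromℤ z = ℚ.toℚᵘ-fromℚᵘ (mkℚᵘ z 0)

fromℤ-+ : ∀ a b → fromℤ (a ℤ.+ b) ≡ fromℤ a + fromℤ b
fromℤ-+ a b = ℚ.toℚᵘ-injective $ begin
  ℚ.toℚᵘ (fromℤ (a ℤ.+ b))                    ≈⟨ toℚᵘ-fromℤ (a ℤ.+ b) ⟩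
  mkℚᵘ (a ℤ.+ b) 0                            ≈⟨ ℚᵘ.*≡* (cong (ℤ._* 1ℤ) a+b≡) ⟩
  mkℚᵘ a 0 ℚᵘ.+ mkℚᵘ b 0                      ≈⟨ ℚᵘ.+-cong (toℚᵘ-fromℤ a) (toℚᵘ-fromℤ b) ⟨
  ℚ.toℚᵘ (fromℤ a) ℚᵘ.+ ℚ.toℚᵘ (fromℤ b)      ≈⟨ ℚ.toℚᵘ-homo-+ (fromℤ a) (fromℤ b) ⟨
  ℚ.toℚᵘ (fromℤ a + fromℤ b)                  ∎
  where
  open ℚᵘ.≃-Reasoning
  a+b≡ = cong₂ ℤ._+_ (sym (ℤ.*-identityʳ a)) (sym (ℤ.*-identityʳ b))

fromℤ-* : ∀ a b → fromℤ (a ℤ.* b) ≡ fromℤ a * fromℤ b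
fromℤ-* a b = ℚ.toℚᵘ-injective $ begin
  ℚ.toℚᵘ (fromℤ (a ℤ.* b))                    ≈⟨ toℚᵘ-fromℤ (a ℤ.* b) ⟩
  mkℚᵘ a 0 ℚᵘ.* mkℚᵘ b 0                      ≈⟨ ℚᵘ.*-cong (toℚᵘ-fromℤ a) (toℚᵘ-fromℤ b) ⟨
  ℚ.toℚᵘ (fromℤ a) ℚᵘ.* ℚ.toℚᵘ (fromℤ b)      ≈⟨ ℚ.toℚᵘ-homo-* (fromℤ a) (fromℤ b) ⟨
  ℚ.toℚᵘ (fromℤ a * fromℤ b)                  ∎
  where open ℚᵘ.≃-Reasoning

fromℤ-mono-≤ : ∀ {a b} → a ℤ.≤ b → fromℤ a ℚ.≤ fromℤ b
fromℤ-mono-≤ {a} {b} a≤b = ℚ.toℚᵘ-cancel-≤ $ begin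
  ℚ.toℚᵘ (fromℤ a) ≃⟨ toℚᵘ-fromℤ a ⟩
  mkℚᵘ a 0         ≤⟨ ℚᵘ.*≤* (ℤ.*-monoʳ-≤-nonNeg 1ℤ a≤b) ⟩
  mkℚᵘ b 0         ≃⟨ toℚᵘ-fromℤ b ⟨
  ℚ.toℚᵘ (fromℤ b) ∎
  where open ℚᵘ.≤-Reasoning

fromℤ-mono-< : ∀ {a b} → a ℤ.< b → fromℤ a < fromℤ b
fromℤ-mono-< {a} {b} a<b = ℚ.toℚᵘ-cancel-< $ begin-strict
  ℚ.toℚᵘ (fromℤ a) ≃⟨ toℚᵘ-fromℤ a ⟩
  mkℚᵘ a 0         <⟨ ℚᵘ.*<* (ℤ.*-monoʳ-<-pos 1ℤ a<b) ⟩
  mkℚᵘ b 0         ≃⟨ toℚᵘ-fromℤ b ⟨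
  ℚ.toℚᵘ (fromℤ b) ∎
  where open ℚᵘ.≤-Reasoning

*-≡0ˡ : ∀ {a} b → a ≡ 0ℚ → a * b ≡ 0ℚ
*-≡0ˡ b refl = ℚ.*-zeroˡ b

*-≡0ʳ : ∀ a {b} → b ≡ 0ℚ → a * b ≡ 0ℚ
*-≡0ʳ a refl = ℚ.*-zeroʳ a

-- Serves to compare two functionals beyond a common facet: they agree at all vertices but `k`, and
-- the negative weight there reverses the inequality.
combination-<-neg : ∀ {m} {c a b : Vector ℚ m} k → c k < 0ℚ → b k < a k → (∀ i → i ≢ k → a i ≡ b i) →
                    sum (λ i → c i * a i) < sum (λ i → c i * b i)
combination-<-neg {c = c} {a} {b} k cₖ<0 bₖ<aₖ a≡b = sum-mono-< term≤ k term<
  where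
  term< : c k * a k < c k * b k
  term< = ℚ.*-monoʳ-<-neg (c k) {{ℚ.negative cₖ<0}} bₖ<aₖ
  term≤ : ∀ i → c i * a i ℚ.≤ c i * b i
  term≤ i with i Fin.≟ k
  ... | yes refl = ℚ.<⇒≤ term<
  ... | no  i≢k  = ℚ.≤-reflexive (cong (c i *_) (a≡b i i≢k))

conv-constant : ∀ {d} {X : Region d} (u : Vector ℚ d) b → (∀ x → X x → ⟨ u , x ⟩ ≡ b) →
                ∀ x → conv X x → ⟨ u , x ⟩ ≡ b
conv-constant u b X≡b x (m , c , p , X-p , _ , Σc≡1 , x≗) = begin
  ⟨ u , x ⟩                       ≡⟨ trans (⟨⟩-congʳ u x≗) (⟨⟩-combination u c p) ⟩
  sum (λ i → c i * ⟨ u , p i ⟩)   ≡⟨ sum-cong (λ i → cong (c i *_) (X≡b (p i) (X-p i))) ⟩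
  sum (λ i → c i * b)             ≡⟨ Σℚ.*-distribʳ-sum b c ⟨
  sum c * b                       ≡⟨ trans (cong (_* b) Σc≡1) (ℚ.*-identityˡ b) ⟩
  b                               ∎
  where open ≡-Reasoning

-- Charts of unimodular simplices

-- On closed data the equation is `refl`, so type checking evaluates only the Boolean and not the
-- proof that comes with it.
decided : ∀ {A : Set} (a? : Dec A) → does a? ≡ true → A
decided (yes a) _ = a

infixl 7 _∙_

_∙_ : ∀ {n} → Vec ℤ n → Vec ℤ n → ℤ
[]      ∙ []      = 0ℤ
(a ∷ u) ∙ (b ∷ v) = a ℤ.* b ℤ.+ u ∙ v

-- Supplies the signs of a cofactor expansion.
alternate : ∀ {n} → Vec ℤ n → Vec ℤ n
alternate []      = []
alternate (a ∷ u) = a ∷ Vec.map ℤ.-_ (alternate u)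

-- The generalised cross product: r ∙ cross M is the determinant of r ∷ M.
cross : ∀ {n} → Vec (Vec ℤ (suc n)) n → Vec ℤ (suc n)
cross {zero}  []      = 1ℤ ∷ []
cross {suc n} (r ∷ M) = alternate (Vec.tabulate λ j →
  minor (Vec.removeAt r j) (Vec.map (λ q → Vec.removeAt q j) M))
  where
  minor : Vec ℤ (suc n) → Vec (Vec ℤ (suc n)) n → ℤ
  minor r M = r ∙ cross M

column : ∀ {m n} → Fin n → Vec (Vec ℤ n) m → Vec ℤ m
column j = Vec.map (λ r → lookup r j)

-- coords are the barycentric coordinates of the simplex, and lift is the affine function through
-- its lifted vertices.  Affine functions on C are written as linear functionals, as x₁ + x₂ = 1.
record Chart : Set where
  constructor mkChart
  field
    vertices : Vec Index 5
    cell     : Cell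
    coords   : Vec (Vec ℤ 5) 5
    lift     : Vec ℤ 5

vertexPoints : Vec Index 5 → Vec (Vec ℤ 5) 5
vertexPoints = Vec.map (lookup latticeC)

hull : Vec Index 5 → Cell
hull v = ⋃ (List.map ⁅_⁆ (Vec.toList v))

-- For det P = ± 1 the factor p ∙ x is ± 1, so multiplying by it divides x by p ∙ x.
dualBasis : Vec (Vec ℤ 5) 5 → Vec (Vec ℤ 5) 5
dualBasis P = Vec.tabulate λ k → orient (lookup P k) (cross (Vec.removeAt P k))
  where
  orient : Vec ℤ 5 → Vec ℤ 5 → Vec ℤ 5
  orient p x = Vec.map ((p ∙ x) ℤ.*_) x

Heights : Set
Heights = Vec ℕ 20

height : Heights → Index → ℤ
height w i = ℤ.+ lookup w i

-- The functional with prescribed values at the vertices is the sum of the barycentric coordinates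
-- weighted by these values, here computed column by column. As an argument of `withCoords` the
-- coordinates are shared by both fields.
chart : Heights → Vec Index 5 → Chart
chart w v = withCoords (dualBasis (vertexPoints v))
  where
  withCoords : Vec (Vec ℤ 5) 5 → Chart
  withCoords ℓ = mkChart v (hull v) ℓ (Vec.tabulate λ j → Vec.map (height w) v ∙ column j ℓ)

δ : ∀ {n} → Fin n → Fin n → ℤ
δ i j = if does (i Fin.≟ j) then 1ℤ else 0ℤ

module _ (w : Heights) (charts : List Chart) (s : Chart) where
  open Chart s

  -- Incidence is all that is tested. That the two simplices lie on opposite sides of the facet is
  -- encoded in the heights: the missing vertex lies strictly above the lift of `t`, which
  -- `crossing` exploits.
  Adjacent : Fin 5 → Chart → Set
  Adjacent k t = lookup vertices k ∉ Chart.cell t × (∀ m → m ≢ k → lookup vertices m ∈ Chart.cell t)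

  -- The first two conditions make the matrices of coordinates and of vertices inverse on either
  -- side: one evaluates the coordinates at the vertices, the other expands an arbitrary point. Then
  -- follow strict lower support, the alternative for each facet, and the size and volume of the
  -- simplex.
  Valid : Set
  Valid =
    (∀ k m → lookup coords k ∙ lookup latticeC (lookup vertices m) ≡ δ k m) ×
    (∀ l j → column l coords ∙ column j (vertexPoints vertices) ≡ δ l j) ×
    (∀ i → (i ∈ cell × lift ∙ lookup latticeC i ≡ height w i) ⊎
           (i ∉ cell × lift ∙ lookup latticeC i ℤ.< height w i)) ×
    (∀ k → (∀ i → 0ℤ ℤ.≤ lookup coords k ∙ lookup latticeC i) ⊎ Any (Adjacent k) charts) ×
    ∣ cell ∣ ≡ 5 ×
    normalizedVolume vertices ≡ 1

  valid? : Dec Valid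
  valid? =
    Fin.all? (λ k → Fin.all? λ m → lookup coords k ∙ lookup latticeC (lookup vertices m) ℤ.≟ δ k m) ×-dec
    Fin.all? (λ l → Fin.all? λ j → column l coords ∙ column j (vertexPoints vertices) ℤ.≟ δ l j) ×-dec
    Fin.all? (λ i → (i ∈? cell ×-dec lift ∙ lookup latticeC i ℤ.≟ height w i) ⊎-dec
                    (¬? (i ∈? cell) ×-dec lift ∙ lookup latticeC i ℤ.<? height w i)) ×-dec
    Fin.all? (λ k → Fin.all? (λ i → 0ℤ ℤ.≤? lookup coords k ∙ lookup latticeC i) ⊎-dec
                    Any.any? (λ t → ¬? (lookup vertices k ∈? Chart.cell t) ×-dec
                       Fin.all? (λ m → ¬? (m Fin.≟ k) →-dec lookup vertices m ∈? Chart.cell t)) charts) ×-dec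
    ∣ cell ∣ ℕ.≟ 5 ×-dec
    normalizedVolume vertices ℕ.≟ 1

-- Indices are entered as numerals below 20, so the reduction modulo 20 is vacuous.
Δ : ℕ → ℕ → ℕ → ℕ → ℕ → Vec Index 5
Δ a b c d e = Vec.map (_mod 20) (a ∷ b ∷ c ∷ d ∷ e ∷ [])

fromℤ-∙ : ∀ {n} (u v : Vec ℤ n) → ⟨ fromℤ ∘ lookup u , fromℤ ∘ lookup v ⟩ ≡ fromℤ (u ∙ v)
fromℤ-∙ []      []      = refl
fromℤ-∙ (a ∷ u) (b ∷ v) =
  trans (cong₂ _+_ (sym (fromℤ-* a b)) (fromℤ-∙ u v)) (sym (fromℤ-+ (a ℤ.* b) (u ∙ v)))

δ-diagonal : ∀ {n} (i : Fin n) → δ i i ≡ 1ℤ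
δ-diagonal i with i Fin.≟ i
... | yes _  = refl
... | no i≢i = contradiction refl i≢i

δ-off-diagonal : ∀ {n} {i j : Fin n} → i ≢ j → δ i j ≡ 0ℤ
δ-off-diagonal {i = i} {j} i≢j with i Fin.≟ j
... | yes i≡j = contradiction i≡j i≢j
... | no _    = refl

∈-hull⁻ : ∀ {n} (v : Vec Index n) {i} → i ∈ ⋃ (List.map ⁅_⁆ (Vec.toList v)) → ∃[ k ] i ≡ lookup v k
∈-hull⁻ []      i∈ = contradiction i∈ Subset.∉⊥
∈-hull⁻ (a ∷ v) i∈ with Subset.x∈p∪q⁻ ⁅ a ⁆ _ i∈
... | inj₁ i∈a = zero , Subset.x∈⁅y⁆⇒x≡y a i∈a
... | inj₂ i∈v with k , i≡ ← ∈-hull⁻ v i∈v = suc k , i≡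

∈-hull⁺ : ∀ {n} (v : Vec Index n) k → lookup v k ∈ ⋃ (List.map ⁅_⁆ (Vec.toList v))
∈-hull⁺ (a ∷ v) zero    = Subset.x∈p∪q⁺ (inj₁ (Subset.x∈⁅x⁆ a))
∈-hull⁺ (a ∷ v) (suc k) = Subset.x∈p∪q⁺ (inj₂ (∈-hull⁺ v k))

⊆∧∣∣≡⇒≡ : ∀ {n} {p q : Subset n} → p ⊆ q → ∣ p ∣ ≡ ∣ q ∣ → p ≡ q
⊆∧∣∣≡⇒≡ {p = []}          {[]}          p⊆q eq = refl
⊆∧∣∣≡⇒≡ {p = outside ∷ p} {outside ∷ q} p⊆q eq = cong (outside ∷_) (⊆∧∣∣≡⇒≡ (Subset.drop-∷-⊆ p⊆q) eq)
⊆∧∣∣≡⇒≡ {p = outside ∷ p} {inside  ∷ q} p⊆q eq =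
  contradiction eq (ℕ.<⇒≢ (ℕ.s≤s (Subset.p⊆q⇒∣p∣≤∣q∣ (Subset.drop-∷-⊆ p⊆q))))
⊆∧∣∣≡⇒≡ {p = inside  ∷ p} {outside ∷ q} p⊆q eq = contradiction (p⊆q Vec.here) λ ()
⊆∧∣∣≡⇒≡ {p = inside  ∷ p} {inside  ∷ q} p⊆q eq =
  cong (inside ∷_) (⊆∧∣∣≡⇒≡ (Subset.drop-∷-⊆ p⊆q) (ℕ.suc-injective eq))

-- From integer certificates to rational simplices

module _ (w : Heights) where

  lifted : Vector ℚ 20
  lifted i = fromℤ (height w i)

  module _ (s : Chart) where
    open Chart s

    vertex : Fin 5 → Index
    vertex = lookup vertices

    coord : Fin 5 → Vector ℚ 5
    coord k = fromℤ ∘ lookup (lookup coords k)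

    slope : Vector ℚ 5
    slope = fromℤ ∘ lookup lift

    -- The geometric content of `Valid` for a single simplex, over ℚ. Facets involve the whole list
    -- and are treated separately. The coordinates are linear functionals, so `expand` holds on all
    -- of ℚ⁵.
    record LowerSimplex : Set where
      field
        vertex-∈   : ∀ k → vertex k ∈ cell
        ∈-vertex   : ∀ i → i ∈ cell → ∃[ k ] i ≡ vertex k
        coord-same : ∀ k → ⟨ coord k , pt (vertex k) ⟩ ≡ 1ℚ
        coord-diff : ∀ k m → k ≢ m → ⟨ coord k , pt (vertex m) ⟩ ≡ 0ℚ
        expand     : ∀ x → x ≗ Σ⟨ (λ k → ⟨ coord k , x ⟩) · pt ∘ vertex ⟩
        touching   : ∀ i → i ∈ cell → ⟨ slope , pt i ⟩ ≡ lifted i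
        below      : ∀ i → i ∉ cell → ⟨ slope , pt i ⟩ < lifted i
        card       : ∣ cell ∣ ≡ 5

      slope≤ : ∀ i → ⟨ slope , pt i ⟩ ℚ.≤ lifted i
      slope≤ i with i ∈? cell
      ... | yes i∈ = ℚ.≤-reflexive (touching i i∈)
      ... | no  i∉ = ℚ.<⇒≤ (below i i∉)

      touching⁻ : ∀ i → ⟨ slope , pt i ⟩ ≡ lifted i → i ∈ cell
      touching⁻ i h≡ with i ∈? cell
      ... | yes i∈ = i∈
      ... | no  i∉ = contradiction h≡ (ℚ.<⇒≢ (below i i∉))

      functional-expand : ∀ (u : Vector ℚ 5) x →
                          ⟨ u , x ⟩ ≡ sum (λ k → ⟨ coord k , x ⟩ * ⟨ u , pt (vertex k) ⟩)
      functional-expand u x =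
        trans (⟨⟩-congʳ u (expand x)) (⟨⟩-combination u (λ k → ⟨ coord k , x ⟩) (pt ∘ vertex))

      -- Applying `coord k` to the vanishing combination leaves just the coefficient at vertex `k`.
      affinelyIndependent : AffinelyIndependent cell
      affinelyIndependent c supp _ Σ≡0 i with i ∈? cell
      ... | no  i∉ = supp i i∉
      ... | yes i∈ with k , refl ← ∈-vertex i i∈ = begin
        c (vertex k)                                  ≡⟨ ℚ.*-identityʳ _ ⟨
        c (vertex k) * 1ℚ                             ≡⟨ cong (c (vertex k) *_) (coord-same k) ⟨
        c (vertex k) * ⟨ coord k , pt (vertex k) ⟩    ≡⟨ sum-single (vertex k) vanish ⟨
        sum (λ j → c j * ⟨ coord k , pt j ⟩)          ≡⟨ ⟨⟩-combination (coord k) c pt ⟨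
        ⟨ coord k , Σ⟨ c · pt ⟩ ⟩                     ≡⟨ sum-≡0 (λ j → *-≡0ʳ (coord k j) (Σ≡0 j)) ⟩
        0ℚ                                            ∎
        where
        open ≡-Reasoning
        vanish : ∀ j → j ≢ vertex k → c j * ⟨ coord k , pt j ⟩ ≡ 0ℚ
        vanish j j≢ with j ∈? cell
        ... | no  j∉ = *-≡0ˡ ⟨ coord k , pt j ⟩ (supp j j∉)
        ... | yes j∈ with m , refl ← ∈-vertex j j∈ =
          *-≡0ʳ (c j) (coord-diff k m (λ k≡m → j≢ (cong vertex (sym k≡m))))

  lowerSimplex : ∀ {charts} s → Chart.cell s ≡ hull (Chart.vertices s) → Valid w charts s → LowerSimplex s
  lowerSimplex s cell≡ (dual , inverse , supports , _ , ∣v∣≡5 , _) = record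
    { vertex-∈   = λ k → subst (vertex s k ∈_) (sym cell≡) (∈-hull⁺ v k)
    ; ∈-vertex   = λ i i∈ → ∈-hull⁻ v (subst (i ∈_) cell≡ i∈)
    ; coord-same = λ k → trans (dualℚ k k) (cong fromℤ (δ-diagonal k))
    ; coord-diff = λ k m k≢m → trans (dualℚ k m) (cong fromℤ (δ-off-diagonal k≢m))
    ; expand     = expand
    ; touching   = touching
    ; below      = below
    ; card       = ∣v∣≡5
    }
    where
    v = Chart.vertices s
    ℓ = Chart.coords s

    dualℚ : ∀ k m → ⟨ coord s k , pt (vertex s m) ⟩ ≡ fromℤ (δ k m)
    dualℚ k m = trans (fromℤ-∙ (lookup ℓ k) (lookup latticeC (lookup v m))) (cong fromℤ (dual k m))

    slope-value : ∀ i → ⟨ slope s , pt i ⟩ ≡ fromℤ (Chart.lift s ∙ lookup latticeC i)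
    slope-value i = fromℤ-∙ (Chart.lift s) (lookup latticeC i)

    touching : ∀ i → i ∈ Chart.cell s → ⟨ slope s , pt i ⟩ ≡ lifted i
    touching i i∈ = [ (λ (_ , h≡) → trans (slope-value i) (cong fromℤ h≡))
                    , (λ (i∉ , _) → contradiction i∈ i∉) ]′ (supports i)

    below : ∀ i → i ∉ Chart.cell s → ⟨ slope s , pt i ⟩ < lifted i
    below i i∉ = [ (λ (i∈ , _) → contradiction i∈ i∉)
                 , (λ (_ , h<) → subst (_< lifted i) (sym (slope-value i)) (fromℤ-mono-< h<)) ]′
                 (supports i)

    inverseℚ : ∀ l j → sum (λ k → coord s k l * pt (vertex s k) j) ≡ fromℤ (δ l j)
    inverseℚ l j = begin
      sum (λ k → coord s k l * pt (vertex s k) j)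
        ≡⟨ sum-cong (λ k → cong₂ (λ a b → fromℤ a * fromℤ b) (Vec.lookup-map k (λ r → lookup r l) ℓ) (point k)) ⟨
      ⟨ fromℤ ∘ lookup (column l ℓ) , fromℤ ∘ lookup (column j (vertexPoints v)) ⟩
        ≡⟨ fromℤ-∙ (column l ℓ) (column j (vertexPoints v)) ⟩
      fromℤ (column l ℓ ∙ column j (vertexPoints v))
        ≡⟨ cong fromℤ (inverse l j) ⟩
      fromℤ (δ l j) ∎
      where
      open ≡-Reasoning
      point : ∀ k → lookup (column j (vertexPoints v)) k ≡ lookup (lookup latticeC (vertex s k)) j
      point k = trans (Vec.lookup-map k (λ r → lookup r j) (vertexPoints v))
                      (cong (λ r → lookup r j) (Vec.lookup-map k (lookup latticeC) v))

    -- Exchanging the two sums brings out the matrix product evaluated by `inverseℚ`.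
    expand : ∀ x → x ≗ Σ⟨ (λ k → ⟨ coord s k , x ⟩) · pt ∘ vertex s ⟩
    expand x j = sym $ begin
      sum (λ k → sum (λ l → coord s k l * x l) * p k)
        ≡⟨ sum-cong (λ k → Σℚ.*-distribʳ-sum (p k) (λ l → coord s k l * x l)) ⟩
      sum (λ k → sum (λ l → coord s k l * x l * p k))
        ≡⟨ Σℚ.∑-comm (λ k l → coord s k l * x l * p k) ⟩
      sum (λ l → sum (λ k → coord s k l * x l * p k))
        ≡⟨ sum-cong (λ l → sum-cong (λ k → rearrange (coord s k l) (x l) (p k))) ⟩
      sum (λ l → sum (λ k → x l * (coord s k l * p k)))
        ≡⟨ sum-cong (λ l → Σℚ.*-distribˡ-sum (x l) (λ k → coord s k l * p k)) ⟨
      sum (λ l → x l * sum (λ k → coord s k l * p k))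
        ≡⟨ sum-cong (λ l → cong (x l *_) (inverseℚ l j)) ⟩
      sum (λ l → x l * fromℤ (δ l j))
        ≡⟨ sum-single j (λ l l≢j → *-≡0ʳ (x l) (cong fromℤ (δ-off-diagonal l≢j))) ⟩
      x j * fromℤ (δ j j)
        ≡⟨ cong (λ d → x j * fromℤ d) (δ-diagonal j) ⟩
      x j * 1ℚ
        ≡⟨ ℚ.*-identityʳ (x j) ⟩
      x j ∎
      where
      open ≡-Reasoning
      p = λ k → pt (vertex s k) j
      rearrange : ∀ a b c → a * b * c ≡ b * (a * c)
      rearrange a b c = trans (cong (_* c) (ℚ.*-comm a b)) (ℚ.*-assoc b a c)

-- Functionals on C

-- For fixed `a` the functional becomes an affine function of `y`, in the form that
-- `affine-combination` expects.
⟨⟩-++ : ∀ (u : Vector ℚ 5) (a : Point 2) (y : Point 3) →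
        ⟨ u , a Vector.++ y ⟩ ≡ ⟨ (λ j → u (suc (suc j))) , y ⟩ + (u zero * a zero + u (suc zero) * a (suc zero))
⟨⟩-++ u a y = begin
  α + (β + γ)   ≡⟨ ℚ.+-assoc α β γ ⟨
  (α + β) + γ   ≡⟨ ℚ.+-comm (α + β) γ ⟩
  γ + (α + β)   ∎
  where
  open ≡-Reasoning
  α = u zero * a zero
  β = u (suc zero) * a (suc zero)
  γ = ⟨ (λ j → u (suc (suc j))) , y ⟩

-- The positions of 0, 2𝐞₁, 2𝐞₂ and 2𝐞₃ in lattice2Δ₃.
corner : Fin 4 → Fin 10
corner zero                = # 0
corner (suc zero)          = # 4
corner (suc (suc zero))    = # 5
corner (suc (suc (suc i))) = # 6

first second : Fin 10 → Index
first  = Fin._↑ˡ 10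
second = 10 Fin.↑ʳ_

vertex₃ : Fin 4 → Point 3
vertex₃ i j = pt (first (corner i)) (suc (suc j))

module _ (u : Vector ℚ 5) (u≥0 : ∀ i → 0ℚ ℚ.≤ ⟨ u , pt i ⟩) where

  ⊠≥0 : ∀ (a : Point 2) (index : Fin 10 → Index) →
        (∀ i {y} → y ≗ vertex₃ i → a Vector.++ y ≗ pt (index (corner i))) →
        ∀ x → (a ⊠ 2Δ₃) x → 0ℚ ℚ.≤ ⟨ u , x ⟩
  ⊠≥0 a index index≗ x (y , (_ , c , p , p∈ , 0≤c , Σc≡1 , y≗) , x≗) = subst (0ℚ ℚ.≤_)
    (sym (trans (⟨⟩-congʳ u x≗) (⟨⟩-++ u a y)))
    (subst (0ℚ ℚ.≤_) (sym (trans (cong (_+ b) (⟨⟩-congʳ u′ y≗)) (affine-combination u′ b c p Σc≡1)))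
      -- The vertices of `2Δ₃` and the entries of `latticeC` agree by computation once both the
      -- vertex and the coordinate are concrete, hence the case distinctions.
      (combination-nonneg 0≤c λ i → case p∈ i of λ
        { (0F , z≗) → at (p i) 0F λ { 0F → z≗ 0F ; 1F → z≗ 1F ; 2F → z≗ 2F }
        ; (1F , z≗) → at (p i) 1F λ { 0F → z≗ 0F ; 1F → z≗ 1F ; 2F → z≗ 2F }
        ; (2F , z≗) → at (p i) 2F λ { 0F → z≗ 0F ; 1F → z≗ 1F ; 2F → z≗ 2F }
        ; (3F , z≗) → at (p i) 3F λ { 0F → z≗ 0F ; 1F → z≗ 1F ; 2F → z≗ 2F }
        }))
    where
    u′ = λ j → u (suc (suc j))
    b = u zero * a zero + u (suc zero) * a (suc zero)
    at : ∀ z i → z ≗ vertex₃ i → 0ℚ ℚ.≤ ⟨ u′ , z ⟩ + b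
    at z i z≗ = subst (0ℚ ℚ.≤_)
      (trans (sym (⟨⟩-congʳ u (index≗ i z≗))) (⟨⟩-++ u a z)) (u≥0 (index (corner i)))

  -- All vertices of `C` are among its lattice points. This places `C` inside `Cone`.
  C≥0 : ∀ x → C x → 0ℚ ℚ.≤ ⟨ u , x ⟩
  C≥0 = conv-linear u λ x →
    [ ⊠≥0 (𝐞 zero) first first≗ x , ⊠≥0 (𝐞 (suc zero)) second second≗ x ]′
    where
    first≗ : ∀ i {y} → y ≗ vertex₃ i → 𝐞 {2} zero Vector.++ y ≗ pt (first (corner i))
    first≗ 0F y≗ = λ { 0F → refl ; 1F → refl ; (suc (suc j)) → y≗ j }
    first≗ 1F y≗ = λ { 0F → refl ; 1F → refl ; (suc (suc j)) → y≗ j }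
    first≗ 2F y≗ = λ { 0F → refl ; 1F → refl ; (suc (suc j)) → y≗ j }
    first≗ 3F y≗ = λ { 0F → refl ; 1F → refl ; (suc (suc j)) → y≗ j }
    second≗ : ∀ i {y} → y ≗ vertex₃ i → 𝐞 {2} (suc zero) Vector.++ y ≗ pt (second (corner i))
    second≗ 0F y≗ = λ { 0F → refl ; 1F → refl ; (suc (suc j)) → y≗ j }
    second≗ 1F y≗ = λ { 0F → refl ; 1F → refl ; (suc (suc j)) → y≗ j }
    second≗ 2F y≗ = λ { 0F → refl ; 1F → refl ; (suc (suc j)) → y≗ j }
    second≗ 3F y≗ = λ { 0F → refl ; 1F → refl ; (suc (suc j)) → y≗ j }

-- The form x₁ + x₂, by which constants on `C` become linear functionals.
total : Vector ℚ 5
total = fromℤ ∘ lookup (1ℤ ∷ 1ℤ ∷ 0ℤ ∷ 0ℤ ∷ 0ℤ ∷ [])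

total-pt : ∀ i → ⟨ total , pt i ⟩ ≡ 1ℚ
total-pt i = trans (fromℤ-∙ (1ℤ ∷ 1ℤ ∷ 0ℤ ∷ 0ℤ ∷ 0ℤ ∷ []) (lookup latticeC i)) (cong fromℤ (sums i))
  where
  sums : ∀ i → (1ℤ ∷ 1ℤ ∷ 0ℤ ∷ 0ℤ ∷ 0ℤ ∷ []) ∙ lookup latticeC i ≡ 1ℤ
  sums = decided (Fin.all? λ i → (1ℤ ∷ 1ℤ ∷ 0ℤ ∷ 0ℤ ∷ 0ℤ ∷ []) ∙ lookup latticeC i ℤ.≟ 1ℤ) refl

total-C : ∀ x → C x → ⟨ total , x ⟩ ≡ 1ℚ
total-C = conv-constant total 1ℚ λ x → [ total-⊠ zero x , total-⊠ (suc zero) x ]′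
  where
  vanish : ∀ (y : Point 3) j → total (suc (suc j)) * y j ≡ 0ℚ
  vanish y zero             = ℚ.*-zeroˡ (y zero)
  vanish y (suc zero)       = ℚ.*-zeroˡ (y (suc zero))
  vanish y (suc (suc zero)) = ℚ.*-zeroˡ (y (suc (suc zero)))

  total-++ : ∀ (a : Fin 2) (y : Point 3) → ⟨ total , 𝐞 {2} a Vector.++ y ⟩ ≡ 1ℚ
  total-++ zero       y = trans (⟨⟩-++ total (𝐞 zero) y) (cong (_+ 1ℚ) (sum-≡0 (vanish y)))
  total-++ (suc zero) y = trans (⟨⟩-++ total (𝐞 (suc zero)) y) (cong (_+ 1ℚ) (sum-≡0 (vanish y)))

  total-⊠ : ∀ (a : Fin 2) x → (𝐞 {2} a ⊠ 2Δ₃) x → ⟨ total , x ⟩ ≡ 1ℚ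
  total-⊠ a x (y , _ , x≗) = trans (⟨⟩-congʳ total x≗) (total-++ a y)

-- By linear programming duality this is the cone spanned by the points pt i.
Cone : Region 5
Cone x = ∀ (u : Vector ℚ 5) → (∀ i → 0ℚ ℚ.≤ ⟨ u , pt i ⟩) → 0ℚ ℚ.≤ ⟨ u , x ⟩

-- The regular triangulation determined by a certificate

module Subdivision
  (w : Heights) (charts : List Chart)
  (lower : ∀ {s} → s List.∈ charts → LowerSimplex w s)
  (facets : ∀ {s} → s List.∈ charts → ∀ k →
            (∀ i → 0ℚ ℚ.≤ ⟨ coord w s k , pt i ⟩) ⊎ Any (Adjacent w charts s k) charts)
  {s₀ : Chart} (s₀∈ : s₀ List.∈ charts)
  where

  open LowerSimplex

  T : List Cell
  T = List.map Chart.cell charts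

  touching-vertex : ∀ {s} → s List.∈ charts → ∀ k → ⟨ slope w s , pt (vertex w s k) ⟩ ≡ lifted w (vertex w s k)
  touching-vertex s∈ k = touching (lower s∈) _ (vertex-∈ (lower s∈) k)

  -- Both lifts are expanded in the coordinates of `s`. They agree on the common facet, and at
  -- vertex `k` that of `t` is strictly smaller, so beyond the facet it is strictly larger.
  crossing : ∀ {s t} → s List.∈ charts → t List.∈ charts → ∀ k → Adjacent w charts s k t →
             ∀ x → ⟨ coord w s k , x ⟩ < 0ℚ → ⟨ slope w s , x ⟩ < ⟨ slope w t , x ⟩
  crossing {s} {t} s∈ t∈ k (k∉t , others∈t) x c<0 = subst₂ _<_
    (sym (functional-expand (lower s∈) (slope w s) x))
    (sym (functional-expand (lower s∈) (slope w t) x))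
    (combination-<-neg {c = λ m → ⟨ coord w s m , x ⟩}
      {λ m → ⟨ slope w s , pt (vertex w s m) ⟩} {λ m → ⟨ slope w t , pt (vertex w s m) ⟩} k c<0
      (subst (⟨ slope w t , pt (vertex w s k) ⟩ <_) (sym (touching-vertex s∈ k)) (below (lower t∈) _ k∉t))
      λ m m≢k → trans (touching-vertex s∈ m) (sym (touching (lower t∈) _ (others∈t m m≢k))))

  -- At a boundary facet the coordinate is nonnegative on all lattice points, hence on `Cone`. At an
  -- interior facet a negative coordinate would let the neighbour exceed the maximum.
  inside-facets : ∀ {s x} → Cone x → s List.∈ charts →
                  (∀ {t} → t List.∈ charts → ⟨ slope w t , x ⟩ ℚ.≤ ⟨ slope w s , x ⟩) →
                  ∀ k → 0ℚ ℚ.≤ ⟨ coord w s k , x ⟩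
  inside-facets {s} {x} x∈ s∈ maximal k = [ x∈ (coord w s k) , interior ]′ (facets s∈ k)
    where
    interior : Any (Adjacent w charts s k) charts → 0ℚ ℚ.≤ ⟨ coord w s k , x ⟩
    interior adjacent = let t , t∈ , s~t = find adjacent in
      ℚ.≮⇒≥ λ c<0 → ℚ.<⇒≢ (ℚ.<-≤-trans (crossing s∈ t∈ k s~t x c<0) (maximal t∈)) refl

  locate : ∀ x → Cone x → ∃[ s ] s List.∈ charts × (∀ k → 0ℚ ℚ.≤ ⟨ coord w s k , x ⟩)
  locate x x∈ = Extrema.argmax f s₀ charts , s∈ , inside-facets {x = x} x∈ s∈ maximal
    where
    f : Chart → ℚ
    f t = ⟨ slope w t , x ⟩

    -- `s₀` is the default value of `argmax` and may itself be the result.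
    s∈ : Extrema.argmax f s₀ charts List.∈ charts
    s∈ = [ (λ s≡s₀ → subst (List._∈ charts) (sym s≡s₀) s₀∈) , id ]′ (Extrema.argmax-sel f s₀ charts)

    maximal : ∀ {t} → t List.∈ charts → f t ℚ.≤ f (Extrema.argmax f s₀ charts)
    maximal = All.lookup (Extrema.f[xs]≤f[argmax] {f = f} s₀ charts)

  ∥∥-value : ∀ {σ : Cell} {x} (u : Vector ℚ 5) ((_ , c , _ , q , _) : ∥ σ ∥ x) →
             ⟨ u , x ⟩ ≡ sum (λ i → c i * ⟨ u , pt (proj₁ (q i)) ⟩)
  ∥∥-value u (_ , c , p , q , _ , _ , x≗) = trans (⟨⟩-congʳ u x≗) (trans (⟨⟩-combination u c p)
    (sum-cong λ i → cong (c i *_) (⟨⟩-congʳ u (proj₂ (proj₂ (q i))))))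

  ∥∥-value-touching : ∀ {t x} → t List.∈ charts → (x∈ : ∥ Chart.cell t ∥ x) →
                      let (_ , c , _ , q , _) = x∈ in
                      ⟨ slope w t , x ⟩ ≡ sum (λ i → c i * lifted w (proj₁ (q i)))
  ∥∥-value-touching {t} t∈ x∈@(_ , c , _ , q , _) = trans (∥∥-value (slope w t) x∈)
    (sum-cong λ i → cong (c i *_) (touching (lower t∈) (proj₁ (q i)) (proj₁ (proj₂ (q i)))))

  -- The lift of `t` interpolates the heights at the vertices of `t`, and the lift of `s` nowhere
  -- exceeds a height.
  slope-maximal : ∀ {s t x} → s List.∈ charts → t List.∈ charts → ∥ Chart.cell t ∥ x →
                  ⟨ slope w s , x ⟩ ℚ.≤ ⟨ slope w t , x ⟩
  slope-maximal {s} s∈ t∈ x∈@(_ , c , _ , q , 0≤c , _) =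
    subst₂ ℚ._≤_ (sym (∥∥-value (slope w s) x∈)) (sym (∥∥-value-touching t∈ x∈))
      (combination-mono 0≤c (λ i → slope≤ (lower s∈) (proj₁ (q i))))

  -- The representation of `x` over the vertices of `t` is kept. At `x` the lift of `s` is not below
  -- that of `t`, so it touches the heights at each vertex of nonzero weight; `conv-support`
  -- discards the others.
  meet : ∀ {s t x} → s List.∈ charts → t List.∈ charts →
         ∥ Chart.cell s ∥ x → ∥ Chart.cell t ∥ x → ∥ Chart.cell s ∩ Chart.cell t ∥ x
  meet {s} {t} s∈ t∈ x∈s x∈t@(_ , c , p , q , 0≤c , Σc≡1 , x≗) =
    conv-support {X = λ y → ∃[ j ] j ∈ Chart.cell s ∩ Chart.cell t × y ≗ pt j} c p in-both 0≤c Σc≡1 x≗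
    where
    touches-s : ∀ i → c i ≢ 0ℚ → ⟨ slope w s , pt (proj₁ (q i)) ⟩ ≡ lifted w (proj₁ (q i))
    touches-s = combination-tight 0≤c (λ i → slope≤ (lower s∈) (proj₁ (q i)))
      (subst₂ ℚ._≤_ (∥∥-value-touching t∈ x∈t) (∥∥-value (slope w s) x∈t) (slope-maximal t∈ s∈ x∈s))

    in-both : ∀ i → c i ≢ 0ℚ → ∃[ j ] j ∈ Chart.cell s ∩ Chart.cell t × p i ≗ pt j
    in-both i cᵢ≢0 = proj₁ (q i) ,
      Subset.x∈p∩q⁺ (touching⁻ (lower s∈) (proj₁ (q i)) (touches-s i cᵢ≢0) , proj₁ (proj₂ (q i))) ,
      proj₂ (proj₂ (q i))

  -- Expand `total`, which is 1 at each vertex.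
  coords-sum : ∀ {s} → s List.∈ charts → ∀ x → sum (λ k → ⟨ coord w s k , x ⟩) ≡ ⟨ total , x ⟩
  coords-sum {s} s∈ x = sym (trans (functional-expand (lower s∈) total x)
    (sum-cong λ k → trans (cong (⟨ coord w s k , x ⟩ *_) (total-pt (vertex w s k)))
                          (ℚ.*-identityʳ ⟨ coord w s k , x ⟩)))

  isTriangulation : IsTriangulation T
  isTriangulation = record
    { simplices = λ σ σ∈ → let s , s∈ , σ≡ = ∈-map⁻ Chart.cell σ∈ in
        subst IsFullSimplex (sym σ≡) (full s∈)
    ; proper    = λ σ τ σ∈ τ∈ x → let s , s∈ , σ≡ = ∈-map⁻ Chart.cell σ∈
                                      t , t∈ , τ≡ = ∈-map⁻ Chart.cell τ∈ in
        subst₂ (λ σ τ → ∥ σ ∥ x → ∥ τ ∥ x → ∥ σ ∩ τ ∥ x) (sym σ≡) (sym τ≡) (meet s∈ t∈)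
    ; covers    = λ x x∈C → let s , s∈ , coords≥0 = locate x (λ u u≥0 → C≥0 u u≥0 x x∈C) in
        Chart.cell s , ∈-map⁺ Chart.cell s∈ ,
        5 , (λ k → ⟨ coord w s k , x ⟩) , pt ∘ vertex w s ,
        (λ k → vertex w s k , vertex-∈ (lower s∈) k , λ _ → refl) , coords≥0 ,
        trans (coords-sum s∈ x) (total-C x x∈C) , expand (lower s∈) x
    }
    where
    full : ∀ {s} → s List.∈ charts → IsFullSimplex (Chart.cell s)
    full s∈ = card (lower s∈) , affinelyIndependent (lower s∈)

  isRegular : IsRegular T
  isRegular = lifted w , λ F → mk⇔ (lowerFacet F)
    (λ ((u , b , h≤w , h≡w) , σ , σ⊆F , ∣σ∣≡5 , _) → maximalCell u b h≤w h≡w σ⊆F ∣σ∣≡5)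
    where
    lowerFacet : ∀ F → F List.∈ T → IsLowerFacet (lifted w) F
    lowerFacet F F∈ = let s , s∈ , F≡ = ∈-map⁻ Chart.cell F∈ in
      subst (IsLowerFacet (lifted w)) (sym F≡)
        -- The lift is homogeneous, so the constant term is 0.
        ( ( slope w s , 0ℚ
          , (λ i → subst (ℚ._≤ lifted w i) (sym (ℚ.+-identityʳ _)) (slope≤ (lower s∈) i))
          , (λ i → mk⇔ (λ i∈ → trans (ℚ.+-identityʳ _) (touching (lower s∈) i i∈))
                       (λ h≡ → touching⁻ (lower s∈) i (trans (sym (ℚ.+-identityʳ _)) h≡))))
        , Chart.cell s , id , card (lower s∈) , affinelyIndependent (lower s∈))

    module _ {F : Cell} (u : Point 5) (b : ℚ)
             (h≤w : ∀ i → ⟨ u , pt i ⟩ + b ℚ.≤ lifted w i)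
             (h≡w : ∀ i → i ∈ F ⇔ ⟨ u , pt i ⟩ + b ≡ lifted w i)
             {σ : Cell} (σ⊆F : σ ⊆ F) (∣σ∣≡5 : ∣ σ ∣ ≡ 5) where

      -- On C the constant b is the functional b · total.
      u′ : Vector ℚ 5
      u′ j = u j + b * total j

      homogenise : ∀ i → ⟨ u′ , pt i ⟩ ≡ ⟨ u , pt i ⟩ + b
      homogenise i = begin
        sum (λ j → (u j + b * total j) * pt i j)
          ≡⟨ sum-cong (λ j → ℚ.*-distribʳ-+ (pt i j) (u j) (b * total j)) ⟩
        sum (λ j → u j * pt i j + b * total j * pt i j)
          ≡⟨ Σℚ.∑-distrib-+ (λ j → u j * pt i j) (λ j → b * total j * pt i j) ⟩
        h + sum (λ j → b * total j * pt i j)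
          ≡⟨ cong (h +_) (sum-cong (λ j → ℚ.*-assoc b (total j) (pt i j))) ⟩
        h + sum (λ j → b * (total j * pt i j))
          ≡⟨ cong (h +_) (Σℚ.*-distribˡ-sum b (λ j → total j * pt i j)) ⟨
        h + b * ⟨ total , pt i ⟩
          ≡⟨ cong (λ a → h + b * a) (total-pt i) ⟩
        h + b * 1ℚ
          ≡⟨ cong (h +_) (ℚ.*-identityʳ b) ⟩
        h + b ∎
        where
        open ≡-Reasoning
        h = ⟨ u , pt i ⟩

      χ : Vector ℚ 20
      χ i = if does (i ∈? σ) then 1ℚ else 0ℚ

      0≤χ : ∀ i → 0ℚ ℚ.≤ χ i
      0≤χ i with does (i ∈? σ)
      ... | true  = ℚ.*≤* (ℤ.+≤+ ℕ.z≤n)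
      ... | false = ℚ.≤-refl

      χ≢0 : ∀ i → i ∈ σ → χ i ≢ 0ℚ
      χ≢0 i i∈ χ≡0 with i ∈? σ
      χ≢0 i i∈ () | yes _
      ... | no i∉ = i∉ i∈

      χ-touching : ∀ i → χ i * lifted w i ≡ χ i * ⟨ u′ , pt i ⟩
      χ-touching i with i ∈? σ
      ... | yes i∈ = cong (1ℚ *_) (sym (trans (homogenise i) (Equivalence.to (h≡w i) (σ⊆F i∈))))
      ... | no  i∉ = trans (ℚ.*-zeroˡ (lifted w i)) (sym (ℚ.*-zeroˡ ⟨ u′ , pt i ⟩))

      -- Five times the barycentre of σ.
      centre : Point 5
      centre = Σ⟨ χ · pt ⟩

      centre∈ : Cone centre
      centre∈ v v≥0 = subst (0ℚ ℚ.≤_) (sym (⟨⟩-combination v χ pt)) (combination-nonneg 0≤χ v≥0)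

      module _ {s} (s∈ : s List.∈ charts) (coords≥0 : ∀ k → 0ℚ ℚ.≤ ⟨ coord w s k , centre ⟩) where

        -- At the vertices of `s` the lift equals the heights, which bound `u′` from above, and
        -- `centre` is a nonnegative combination of these vertices.
        above : ⟨ u′ , centre ⟩ ℚ.≤ ⟨ slope w s , centre ⟩
        above = subst₂ ℚ._≤_
          (sym (functional-expand (lower s∈) u′ centre))
          (sym (functional-expand (lower s∈) (slope w s) centre))
          (combination-mono {c = λ k → ⟨ coord w s k , centre ⟩} coords≥0 λ k → subst₂ ℚ._≤_
            (sym (homogenise (vertex w s k))) (sym (touching-vertex s∈ k)) (h≤w (vertex w s k)))

        -- As `σ ⊆ F`, the left side is the value of `u′` at `centre`. Slackness then forces the
        -- lift of `s` to touch the heights on all of `σ`.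
        tight : sum (λ i → χ i * lifted w i) ℚ.≤ sum (λ i → χ i * ⟨ slope w s , pt i ⟩)
        tight = subst₂ ℚ._≤_
          (trans (⟨⟩-combination u′ χ pt) (sum-cong (λ i → sym (χ-touching i))))
          (⟨⟩-combination (slope w s) χ pt)
          above

        σ⊆s : σ ⊆ Chart.cell s
        σ⊆s {i} i∈ = touching⁻ (lower s∈) i
          (combination-tight {c = χ} 0≤χ (slope≤ (lower s∈)) tight i (χ≢0 i i∈))

        σ≡s : σ ≡ Chart.cell s
        σ≡s = ⊆∧∣∣≡⇒≡ σ⊆s (trans ∣σ∣≡5 (sym (card (lower s∈))))

        s⊆F : Chart.cell s ⊆ F
        s⊆F i∈ = σ⊆F (subst (_ ∈_) (sym σ≡s) i∈)

        -- The functionals agree at the five vertices of `s`, in terms of which every point expands.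
        same-slope : ∀ i → ⟨ u′ , pt i ⟩ ≡ ⟨ slope w s , pt i ⟩
        same-slope i = trans (functional-expand (lower s∈) u′ (pt i)) (trans
          (sum-cong (λ k → cong (⟨ coord w s k , pt i ⟩ *_) (agree k)))
          (sym (functional-expand (lower s∈) (slope w s) (pt i))))
          where
          agree : ∀ k → ⟨ u′ , pt (vertex w s k) ⟩ ≡ ⟨ slope w s , pt (vertex w s k) ⟩
          agree k = trans (homogenise (vertex w s k)) (trans
            (Equivalence.to (h≡w (vertex w s k)) (s⊆F (vertex-∈ (lower s∈) k)))
            (sym (touching-vertex s∈ k)))

        F⊆s : F ⊆ Chart.cell s
        F⊆s {i} i∈ = touching⁻ (lower s∈) i
          (trans (sym (same-slope i)) (trans (homogenise i) (Equivalence.to (h≡w i) i∈)))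

        F∈T : F List.∈ T
        F∈T = subst (List._∈ T) (Subset.⊆-antisym s⊆F F⊆s) (∈-map⁺ Chart.cell s∈)

      maximalCell : F List.∈ T
      maximalCell = let s , s∈ , coords≥0 = locate centre centre∈ in F∈T s∈ coords≥0

-- Cycles

module _ {A : Set} where

  ∈-zip⁻ : ∀ {B : Set} (xs : List A) (ys : List B) {u v} → (u , v) List.∈ zip xs ys →
           u List.∈ xs × v List.∈ ys
  ∈-zip⁻ (x ∷ xs) (y ∷ ys) (here refl) = here refl , here refl
  ∈-zip⁻ (x ∷ xs) (y ∷ ys) (there p)   = let u∈ , v∈ = ∈-zip⁻ xs ys p in there u∈ , there v∈

  ∈-steps⁻ : ∀ (c : List A) {u v} → (u , v) List.∈ steps c → u List.∈ c × v List.∈ c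
  ∈-steps⁻ (x ∷ xs) p = let u∈ , v∈ = ∈-zip⁻ (x ∷ xs) (xs ∷ʳ x) p in
    u∈ , [ there , (λ { (here refl) → here refl }) ]′ (∈-++⁻ xs v∈)

  ∈-zip-∷ʳ⁻ : ∀ y ys {x z : A} {p} → p List.∈ zip (y ∷ (ys ∷ʳ x)) ((ys ∷ʳ x) ∷ʳ z) →
              p ≡ (x , z) ⊎ p List.∈ zip (y ∷ ys) (ys ∷ʳ x)
  ∈-zip-∷ʳ⁻ y []       (here p≡)         = inj₂ (here p≡)
  ∈-zip-∷ʳ⁻ y []       (there (here p≡)) = inj₁ p≡
  ∈-zip-∷ʳ⁻ y (_ ∷ _)  (here p≡)         = inj₂ (here p≡)
  ∈-zip-∷ʳ⁻ y (y′ ∷ ys) (there p∈)       = [ inj₁ , inj₂ ∘ there ]′ (∈-zip-∷ʳ⁻ y′ ys p∈)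

  ∈-zip-∷ʳ⁺ : ∀ y ys (x z : A) → (x , z) List.∈ zip (y ∷ (ys ∷ʳ x)) ((ys ∷ʳ x) ∷ʳ z)
  ∈-zip-∷ʳ⁺ y []        x z = there (here refl)
  ∈-zip-∷ʳ⁺ y (y′ ∷ ys) x z = there (∈-zip-∷ʳ⁺ y′ ys x z)

  steps-rotate₁ : ∀ zs {x : A} {p} → p List.∈ steps (zs ∷ʳ x) → p List.∈ steps (x ∷ zs)
  steps-rotate₁ []       p∈ = p∈
  steps-rotate₁ (y ∷ ys) p∈ = [ here , there ]′ (∈-zip-∷ʳ⁻ y ys p∈)

  -- Allows an argument about a cycle to start at any of its vertices. Elements of `xs` are moved
  -- one at a time to the end of `ys`, each costing one rotation.
  steps-rotate : ∀ (xs ys : List A) {p} → p List.∈ steps (ys ++ xs) → p List.∈ steps (xs ++ ys)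
  steps-rotate []       ys p∈ = subst (λ zs → _ List.∈ steps zs) (List.++-identityʳ ys) p∈
  steps-rotate (x ∷ xs) ys p∈ = steps-rotate₁ (xs ++ ys)
    (subst (λ zs → _ List.∈ steps zs) (sym (List.++-assoc xs ys (x ∷ [])))
      (steps-rotate xs (ys ∷ʳ x)
        (subst (λ zs → _ List.∈ steps zs) (sym (List.++-assoc ys (x ∷ []) xs)) p∈)))

  length≤1 : ∀ {xs : List A} {a b} → length xs ≤ 1 → a List.∈ xs → b List.∈ xs → a ≡ b
  length≤1 {_ ∷ []}    _        (here refl) (here refl) = refl
  length≤1 {_ ∷ _ ∷ _} (s≤s ()) _           _

  length≤2 : ∀ {xs : List A} {a b c} → length xs ≤ 2 → a List.∈ xs → b List.∈ xs → c List.∈ xs →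
             a ≢ b → c ≡ a ⊎ c ≡ b
  length≤2 _         (here refl) _           (here refl) a≢b = inj₁ refl
  length≤2 _         _           (here refl) (here refl) a≢b = inj₂ refl
  length≤2 _         (here refl) (here refl) _           a≢b = contradiction refl a≢b
  length≤2 (s≤s ∣xs∣≤1) (there a∈) (there b∈) _         a≢b = contradiction (length≤1 ∣xs∣≤1 a∈ b∈) a≢b
  length≤2 (s≤s ∣xs∣≤1) (here refl) (there b∈) (there c∈) _ = inj₂ (length≤1 ∣xs∣≤1 c∈ b∈)
  length≤2 (s≤s ∣xs∣≤1) (there a∈) (here refl) (there c∈) _ = inj₁ (length≤1 ∣xs∣≤1 c∈ a∈)

  module _ {P : A → Set} where

    -- The closing vertex `z` is arbitrary because it stays fixed while the induction shortens the
    -- list.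
    steps-forward : ∀ x xs {z} → (∀ {u v} → (u , v) List.∈ zip (x ∷ xs) (xs ∷ʳ z) → P u → P v) →
                    P x → ∀ {v} → v List.∈ x ∷ xs → P v
    steps-forward x xs       step px (here refl) = px
    steps-forward x (y ∷ xs) step px (there v∈)  = steps-forward y xs (step ∘ there) (step (here refl) px) v∈

    steps-backward : ∀ x xs {z} → (∀ {u v} → (u , v) List.∈ zip (x ∷ xs) (xs ∷ʳ z) → P v → P u) →
                     ∀ {v} → v List.∈ x ∷ xs → P v → P x
    steps-backward x xs       step (here refl) pv = pv
    steps-backward x (y ∷ xs) step (there v∈)  pv = step (here refl) (steps-backward y xs (step ∘ there) v∈ pv)

module _ {A : Set} (Γ : Graph A) where

  onCycle-∈ˡ : ∀ c {u v} → OnCycle Γ c u v → u List.∈ c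
  onCycle-∈ˡ c = [ proj₁ ∘ ∈-steps⁻ c , proj₂ ∘ ∈-steps⁻ c ]′

  onCycle-∈ʳ : ∀ c {u v} → OnCycle Γ c u v → v List.∈ c
  onCycle-∈ʳ c = [ proj₂ ∘ ∈-steps⁻ c , proj₁ ∘ ∈-steps⁻ c ]′

  -- Go back from `u` to the first vertex of the list, then forward to `v`.
  onCycle-connected : ∀ {P : A → Set} c → (∀ {u v} → OnCycle Γ c u v → P u → P v) →
                      ∀ {u v} → u List.∈ c → v List.∈ c → P u → P v
  onCycle-connected (x ∷ xs) step u∈ v∈ pu =
    steps-forward x xs (step ∘ inj₁) (steps-backward x xs (step ∘ inj₂) u∈ pu) v∈

  -- Rotate the cycle so that it starts at `u`. The second and the last vertex are neighbours of
  -- `u`, and they differ since at least three distinct vertices are listed.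
  twoNeighbours : ∀ {c u} → IsCycle Γ c → u List.∈ c →
                  ∃[ a ] ∃[ b ] a ≢ b × OnCycle Γ c u a × OnCycle Γ c u b
  twoNeighbours {c} {u} (3≤∣c∣ , unique , _) u∈ with xs , ys , refl ← ∈-∃++ u∈ =
    ends (ys ++ xs)
      (subst (3 ≤_) (↭-length rotated) 3≤∣c∣)
      (Permutation.Unique-resp-↭ (setoid A) (↭⇒↭ₛ rotated) unique)
      (steps-rotate xs (u ∷ ys))
    where
    rotated : xs ++ u ∷ ys ↭ u ∷ ys ++ xs
    rotated = ++-comm xs (u ∷ ys)

    ends : ∀ zs → 3 ≤ length (u ∷ zs) → Unique (u ∷ zs) →
           (∀ {p} → p List.∈ steps (u ∷ zs) → p List.∈ steps c) →
           ∃[ a ] ∃[ b ] a ≢ b × OnCycle Γ c u a × OnCycle Γ c u b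
    ends (a ∷ zs) 3≤ (_ ∷ a∉ ∷ _) ⊆c with initLast zs
    ends (a ∷ .[]) (s≤s (s≤s ())) _ _ | []
    ... | ys ∷ʳ′ b = a , b , All.lookup a∉ (∈-++⁺ʳ ys (here refl)) ,
                     inj₁ (⊆c (here refl)) , inj₂ (⊆c (∈-zip-∷ʳ⁺ u (a ∷ ys) b u))
    ends [] (s≤s ()) _ _

-- Uniqueness of the cycle by deleting vertices

module Peeling {A : Set} {R : Rel A 0ℓ} (R? : Decidable R) where

  degree : A → List A → ℕ
  degree u xs = length (filter (R? u) xs)

  -- The degree is taken among the vertices not yet deleted, so the order of `ys` matters.
  Peelable : List A → List A → Set
  Peelable []       c = ⊤
  Peelable (y ∷ ys) c = degree y (y ∷ ys ++ c) ≤ 1 × Peelable ys c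

  peelable? : ∀ ys c → Dec (Peelable ys c)
  peelable? []       c = yes tt
  peelable? (y ∷ ys) c = degree y (y ∷ ys ++ c) ℕ.≤? 1 ×-dec peelable? ys c

-- R stands in for the edge relation: for G(T) it omits the costly membership in T.
module CycleUniqueness
  {A : Set} (Γ : Graph A) {R : Rel A 0ℓ} (R? : Decidable R) (R-sym : Symmetric R)
  (Edge⇒R : ∀ {u v} → Graph.Edge Γ u v → R u v)
  where

  open Peeling R?

  onCycle⇒R : ∀ {c} → IsCycle Γ c → ∀ {u v} → OnCycle Γ c u v → R u v
  onCycle⇒R (_ , _ , edges) = [ Edge⇒R ∘ All.lookup edges , R-sym ∘ Edge⇒R ∘ All.lookup edges ]′

  -- A vertex on the cycle `d` has two distinct neighbours on `d`, all still present, so a vertex of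
  -- degree at most one is not on `d`.
  peel : ∀ {c d} ys → Peelable ys c → IsCycle Γ d → (∀ {u} → u List.∈ d → u List.∈ ys ++ c) →
         ∀ {u} → u List.∈ d → u List.∈ c
  peel []       _            cycle d⊆ = d⊆
  peel {c} {d} (y ∷ ys) (deg≤1 , peelable) cycle d⊆ = peel ys peelable cycle d⊆′
    where
    y∉d : ¬ y List.∈ d
    y∉d y∈ = let a , b , a≢b , ya , yb = twoNeighbours Γ cycle y∈ in
      a≢b (length≤1 deg≤1 (neighbour ya) (neighbour yb))
      where
      neighbour : ∀ {a} → OnCycle Γ d y a → a List.∈ filter (R? y) (y ∷ ys ++ c)
      neighbour ya = ∈-filter⁺ (R? y) (d⊆ (onCycle-∈ʳ Γ d ya)) (onCycle⇒R cycle ya)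

    d⊆′ : ∀ {u} → u List.∈ d → u List.∈ ys ++ c
    d⊆′ u∈ with d⊆ u∈
    ... | here refl = contradiction u∈ y∉d
    ... | there u∈′ = u∈′

  -- The two neighbours of `u` along `d` already exhaust its neighbours in `c`. This is used both
  -- for `c` itself and for a competing cycle.
  chordless : ∀ {c d u v} → degree u c ≤ 2 → IsCycle Γ d → (∀ {u} → u List.∈ d → u List.∈ c) →
              u List.∈ d → v List.∈ c → R u v → OnCycle Γ d u v
  chordless {c} {d} {u} deg≤2 cycle d⊆c u∈ v∈ uv =
    let a , b , a≢b , ua , ub = twoNeighbours Γ cycle u∈ in
    [ (λ v≡a → subst (OnCycle Γ d u) (sym v≡a) ua) , (λ v≡b → subst (OnCycle Γ d u) (sym v≡b) ub) ]′
      (length≤2 deg≤2 (neighbour ua) (neighbour ub) (∈-filter⁺ (R? u) v∈ uv) a≢b)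
    where
    neighbour : ∀ {a} → OnCycle Γ d u a → a List.∈ filter (R? u) c
    neighbour ua = ∈-filter⁺ (R? u) (d⊆c (onCycle-∈ʳ Γ d ua)) (onCycle⇒R cycle ua)

  -- Peeling puts any cycle `d` inside `c`, and as `c` has no chords the edges of `d` are edges of
  -- `c`. Conversely, at a vertex of `d` both edges of `c` belong to `d`, and this spreads around
  -- the connected `c`.
  uniqueCycle : ∀ {c} ys → (∀ {u v} → Graph.Edge Γ u v → u List.∈ ys ++ c × v List.∈ ys ++ c) →
                Peelable ys c → All (λ u → degree u c ≤ 2) c → IsCycle Γ c →
                UniqueCycleHasLength Γ (length c)
  uniqueCycle {c} ys vertices peelable deg≤2 cycle = c , cycle , refl , λ d cycle′ u v → mk⇔
    (λ uv → chordless (All.lookup deg≤2 (d⊆c cycle′ (onCycle-∈ˡ Γ d uv))) cycle id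
              (d⊆c cycle′ (onCycle-∈ˡ Γ d uv)) (d⊆c cycle′ (onCycle-∈ʳ Γ d uv)) (onCycle⇒R cycle′ uv))
    (λ uv → along cycle′ uv (c⊆d cycle′ (onCycle-∈ˡ Γ c uv)))
    where
    module _ {d} (cycle′ : IsCycle Γ d) where
      d⊆c : ∀ {u} → u List.∈ d → u List.∈ c
      d⊆c = peel ys peelable cycle′ λ u∈ →
        let _ , _ , _ , ua , _ = twoNeighbours Γ cycle′ u∈ in onCycle-vertex ua
        where
        onCycle-vertex : ∀ {u v} → OnCycle Γ d u v → u List.∈ ys ++ c
        onCycle-vertex = [ proj₁ ∘ vertices ∘ All.lookup (proj₂ (proj₂ cycle′))
                         , proj₂ ∘ vertices ∘ All.lookup (proj₂ (proj₂ cycle′)) ]′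

      along : ∀ {u v} → OnCycle Γ c u v → u List.∈ d → OnCycle Γ d u v
      along uv u∈ = chordless (All.lookup deg≤2 (onCycle-∈ˡ Γ c uv)) cycle′ d⊆c u∈
        (onCycle-∈ʳ Γ c uv) (onCycle⇒R cycle uv)

      c⊆d : ∀ {v} → v List.∈ c → v List.∈ d
      c⊆d v∈ = let _ , u∈ = nonempty d (proj₁ cycle′) in
        onCycle-connected Γ c (λ uv u∈ → onCycle-∈ʳ Γ d (along uv u∈)) (d⊆c u∈) v∈ u∈
        where
        nonempty : ∀ xs → 3 ≤ length xs → ∃[ x ] x List.∈ xs
        nonempty (x ∷ _) _ = x , here refl

-- Certificates

-- Definitionally equal to the relation local to `G`.
ShareQuad : Rel Cell 0ℓ
ShareQuad σ τ = ∣ Q₁ (σ ∩ τ) ∣ ≡ 2 × ∣ Q₂ (σ ∩ τ) ∣ ≡ 2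

shareQuad? : Decidable ShareQuad
shareQuad? σ τ = shared? (σ ∩ τ)
  where
  shared? : ∀ ρ → Dec (∣ Q₁ ρ ∣ ≡ 2 × ∣ Q₂ ρ ∣ ≡ 2)
  shared? ρ = ∣ Q₁ ρ ∣ ℕ.≟ 2 ×-dec ∣ Q₂ ρ ∣ ℕ.≟ 2

shareQuad-sym : Symmetric ShareQuad
shareQuad-sym {σ} {τ} = subst (λ ρ → ∣ Q₁ ρ ∣ ≡ 2 × ∣ Q₂ ρ ∣ ≡ 2) (Subset.∩-comm σ τ)

open Peeling shareQuad? using (degree; Peelable; peelable?)

-- Membership in the triangulation is absent from the computed conditions: it holds by construction
-- for the list `ys ++ c`.
Unicyclic : List Cell → List Cell → Set
Unicyclic ys c =
  Peelable ys c × All (λ σ → degree σ c ≤ 2) c ×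
  3 ≤ length c × Unique c × All IsMixed c × All (uncurry ShareQuad) (steps c)

unicyclic? : ∀ ys c → Dec (Unicyclic ys c)
unicyclic? ys c =
  peelable? ys c ×-dec All.all? (λ σ → degree σ c ℕ.≤? 2) c ×-dec
  3 ℕ.≤? length c ×-dec unique? c ×-dec
  All.all? (λ σ → 2 ℕ.≤? ∣ Q₁ σ ∣ ×-dec 2 ℕ.≤? ∣ Q₂ σ ∣) c ×-dec
  All.all? (uncurry shareQuad?) (steps c)

unicyclic⇒uniqueCycle : ∀ ys c → Unicyclic ys c → UniqueCycleHasLength (G (ys ++ c)) (length c)
unicyclic⇒uniqueCycle ys c (peelable , deg≤2 , 3≤∣c∣ , unique , mixed , quads) =
  CycleUniqueness.uniqueCycle (G (ys ++ c)) shareQuad? (λ {σ} {τ} → shareQuad-sym {σ} {τ})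
    (λ (_ , _ , quad) → quad) ys (λ ((σ∈ , _) , (τ∈ , _) , _) → σ∈ , τ∈) peelable deg≤2
    (3≤∣c∣ , unique , All.tabulate edge)
  where
  vertex∈ : ∀ {σ} → σ List.∈ c → Graph.Vertex (G (ys ++ c)) σ
  vertex∈ σ∈ = ∈-++⁺ʳ ys σ∈ , All.lookup mixed σ∈
  edge : ∀ {e} → e List.∈ steps c → uncurry (Graph.Edge (G (ys ++ c))) e
  edge e∈ = let σ∈ , τ∈ = ∈-steps⁻ c e∈ in vertex∈ σ∈ , vertex∈ τ∈ , All.lookup quads e∈

-- cycle lists the mixed simplices on the cycle of G(T) in cyclic order; rest lists the unmixed
-- simplices followed by the remaining vertices of G(T), leaves first.
record Curve : Set where
  field
    heights : Heights
    rest    : List (Vec Index 5)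
    cycle   : List (Vec Index 5)

  charts : List Chart
  charts = List.map (chart heights) (rest ++ cycle)

  -- Free of charts, so that the graph is checked without evaluating barycentric coordinates.
  cells : List Cell
  cells = List.map hull rest ++ List.map hull cycle

Certified : Curve → Set
Certified 𝒞 = All (Valid heights charts) charts × Unicyclic (List.map hull rest) (List.map hull cycle)
  where open Curve 𝒞

certified? : ∀ 𝒞 → Dec (Certified 𝒞)
certified? 𝒞 = valid-all? charts ×-dec unicyclic? (List.map hull rest) (List.map hull cycle)
  where
  open Curve 𝒞
  -- As an argument the list of charts is shared between all evaluations of it.
  valid-all? : ∀ ss → Dec (All (Valid heights ss) ss)
  valid-all? ss = All.all? (valid? heights ss) ss

module _ (w : Heights) (charts : List Chart)
         (cell≡hull : All (λ s → Chart.cell s ≡ hull (Chart.vertices s)) charts)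
         (valid : All (Valid w charts) charts) {s₀} (s₀∈ : s₀ List.∈ charts) where

  facets : ∀ {s} → s List.∈ charts → ∀ k →
           (∀ i → 0ℚ ℚ.≤ ⟨ coord w s k , pt i ⟩) ⊎ Any (Adjacent w charts s k) charts
  facets {s} s∈ k = let _ , _ , _ , boundary , _ = All.lookup valid s∈ in Sum.map₁
    (λ ≥0 i → subst (0ℚ ℚ.≤_) (sym (fromℤ-∙ (lookup (Chart.coords s) k) (lookup latticeC i))) (fromℤ-mono-≤ (≥0 i)))
    (boundary k)

  open Subdivision w charts (λ {s} s∈ → lowerSimplex w s (All.lookup cell≡hull s∈) (All.lookup valid s∈)) facets s₀∈

  isUnimodular : IsUnimodular T
  isUnimodular σ σ∈ = let s , s∈ , σ≡ = ∈-map⁻ Chart.cell σ∈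
                          _ , _ , _ , _ , _ , volume≡1 = All.lookup valid s∈ in
    Chart.vertices s , trans σ≡ (All.lookup cell≡hull s∈) , volume≡1

  regularUnimodular : IsTriangulation T × IsRegular T × IsUnimodular T
  regularUnimodular = isTriangulation , isRegular , isUnimodular

certified⇒corollary : ∀ 𝒞 → Certified 𝒞 →
  let T = Curve.cells 𝒞 in
  IsTriangulation T × IsRegular T × IsUnimodular T × UniqueCycleHasLength (G T) (length (Curve.cycle 𝒞))
certified⇒corollary 𝒞 (valid , unicyclic@(_ , _ , 3≤∣c∣ , _)) =
  let isT , isR , isU = results in isT , isR , isU ,
  subst (UniqueCycleHasLength (G cells)) (List.length-map hull cycle) (unicyclic⇒uniqueCycle _ _ unicyclic)
  where
  open Curve 𝒞

  -- The cycle is nonempty and so supplies the default chart of `locate`.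
  chart∈ : ∀ vs → 3 ≤ length (List.map hull vs) → ∃[ s ] s List.∈ List.map (chart heights) (rest ++ vs)
  chart∈ (v ∷ vs) _ = chart heights v , ∈-map⁺ (chart heights) (∈-++⁺ʳ rest (here refl))

  results : IsTriangulation cells × IsRegular cells × IsUnimodular cells
  results = subst (λ T → IsTriangulation T × IsRegular T × IsUnimodular T)
    -- By definition the cell of `chart heights v` is `hull v`, so mapping `Chart.cell` over
    -- `charts` gives `cells`.
    (trans (sym (List.map-∘ (rest ++ cycle))) (List.map-++ hull rest cycle))
    (regularUnimodular heights charts (All.map⁺ (All.tabulate λ _ → refl)) valid (proj₂ (chart∈ cycle 3≤∣c∣)))

-- The heights below were found by a random walk in the space of height functions.

curve₃ : Curve
curve₃ = record
  { heights = 15 ∷ 16 ∷ 4 ∷ 15 ∷ 26 ∷ 20 ∷ 17 ∷ 17 ∷ 17 ∷ 16 ∷ 15 ∷ 0 ∷ 6 ∷ 1 ∷ 3 ∷ 9 ∷ 11 ∷ 0 ∷ 5 ∷ 9 ∷ []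
  ; rest =
        Δ 0 1 2 3 11 ∷ Δ 1 2 3 8 11 ∷ Δ 1 2 4 8 14 ∷ Δ 2 3 6 8 11 ∷ Δ 2 4 7 8 14
      ∷ Δ 2 5 7 9 17 ∷ Δ 2 6 8 9 17 ∷ Δ 2 7 8 9 17 ∷ Δ 2 10 11 12 13 ∷ Δ 2 11 12 13 17
      ∷ Δ 2 11 13 14 17 ∷ Δ 2 12 13 15 17 ∷ Δ 2 13 14 17 18 ∷ Δ 2 13 15 17 19 ∷ Δ 2 13 16 17 19
      ∷ Δ 6 13 16 17 18 ∷ Δ 0 2 10 11 13 ∷ Δ 0 2 3 11 13 ∷ Δ 1 2 8 11 14 ∷ Δ 2 3 6 11 13
      ∷ Δ 2 5 9 15 17 ∷ Δ 2 6 8 11 14 ∷ Δ 2 6 11 13 14 ∷ Δ 2 7 8 14 17 ∷ Δ 2 6 8 14 17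
      ∷ Δ 2 9 15 17 19 ∷ Δ 2 6 9 17 19 ∷ Δ 2 6 16 17 19 ∷ Δ 2 6 13 16 17 ∷ []
  ; cycle =
        Δ 2 6 13 14 18 ∷ Δ 2 6 13 17 18 ∷ Δ 2 6 14 17 18 ∷ []
  }

curve₄ : Curve
curve₄ = record
  { heights = 9 ∷ 6 ∷ 0 ∷ 7 ∷ 10 ∷ 10 ∷ 12 ∷ 8 ∷ 3 ∷ 0 ∷ 9 ∷ 7 ∷ 4 ∷ 4 ∷ 9 ∷ 9 ∷ 7 ∷ 8 ∷ 5 ∷ 1 ∷ []
  ; rest =
        Δ 0 1 2 8 13 ∷ Δ 0 2 3 8 13 ∷ Δ 1 2 4 8 14 ∷ Δ 2 3 8 9 13 ∷ Δ 2 4 7 9 14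
      ∷ Δ 2 4 8 9 14 ∷ Δ 2 5 7 9 15 ∷ Δ 2 10 11 12 13 ∷ Δ 2 11 12 13 19 ∷ Δ 2 11 12 14 19
      ∷ Δ 2 11 13 18 19 ∷ Δ 2 11 14 18 19 ∷ Δ 2 12 14 17 19 ∷ Δ 2 12 15 17 19 ∷ Δ 3 6 8 9 16
      ∷ Δ 8 13 16 18 19 ∷ Δ 0 1 2 10 13 ∷ Δ 1 2 8 11 14 ∷ Δ 1 2 10 11 13 ∷ Δ 1 2 8 11 13
      ∷ Δ 2 7 9 14 17 ∷ Δ 2 7 9 15 17 ∷ Δ 2 9 15 17 19 ∷ Δ 2 9 14 17 19 ∷ Δ 2 8 9 14 19
      ∷ Δ 3 8 9 13 16 ∷ Δ 8 9 13 16 19 ∷ Δ 2 8 9 13 19 ∷ []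
  ; cycle =
        Δ 2 8 11 13 18 ∷ Δ 2 8 11 14 18 ∷ Δ 2 8 14 18 19 ∷ Δ 2 8 13 18 19 ∷ []
  }

curve₅ : Curve
curve₅ = record
  { heights = 11 ∷ 6 ∷ 10 ∷ 8 ∷ 7 ∷ 11 ∷ 11 ∷ 0 ∷ 4 ∷ 5 ∷ 12 ∷ 12 ∷ 10 ∷ 11 ∷ 16 ∷ 12 ∷ 12 ∷ 11 ∷ 8 ∷ 7 ∷ []
  ; rest =
        Δ 0 1 3 7 10 ∷ Δ 0 2 7 9 12 ∷ Δ 0 3 7 9 10 ∷ Δ 1 3 7 8 10 ∷ Δ 1 4 7 8 18
      ∷ Δ 2 5 7 9 12 ∷ Δ 3 6 8 9 16 ∷ Δ 3 7 8 9 19 ∷ Δ 7 10 11 12 18 ∷ Δ 7 10 12 18 19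
      ∷ Δ 7 10 13 18 19 ∷ Δ 7 11 12 17 18 ∷ Δ 7 11 14 17 18 ∷ Δ 7 12 15 17 19 ∷ Δ 7 12 17 18 19
      ∷ Δ 8 13 16 18 19 ∷ Δ 0 7 9 10 12 ∷ Δ 3 8 9 16 19 ∷ Δ 3 8 13 16 19 ∷ Δ 4 7 11 14 18
      ∷ Δ 1 4 7 11 18 ∷ Δ 1 7 10 11 18 ∷ Δ 1 7 8 10 18 ∷ Δ 5 7 9 12 15 ∷ Δ 7 9 12 15 19
      ∷ Δ 7 9 10 12 19 ∷ Δ 3 7 9 10 19 ∷ []
  ; cycle =
        Δ 3 7 8 10 13 ∷ Δ 3 7 10 13 19 ∷ Δ 3 7 8 13 19 ∷ Δ 7 8 13 18 19 ∷ Δ 7 8 10 13 18 ∷ []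
  }

curve₆ : Curve
curve₆ = record
  { heights = 13 ∷ 8 ∷ 4 ∷ 14 ∷ 10 ∷ 10 ∷ 16 ∷ 0 ∷ 11 ∷ 2 ∷ 12 ∷ 10 ∷ 12 ∷ 9 ∷ 16 ∷ 14 ∷ 9 ∷ 14 ∷ 6 ∷ 7 ∷ []
  ; rest =
        Δ 0 1 2 9 13 ∷ Δ 0 1 3 9 16 ∷ Δ 1 2 7 9 13 ∷ Δ 1 3 6 9 16 ∷ Δ 1 4 7 8 18
      ∷ Δ 1 6 8 9 16 ∷ Δ 1 7 8 9 18 ∷ Δ 2 5 7 9 15 ∷ Δ 7 10 11 12 19 ∷ Δ 7 10 11 18 19
      ∷ Δ 7 10 13 18 19 ∷ Δ 7 11 12 15 19 ∷ Δ 7 11 14 17 18 ∷ Δ 7 11 15 17 18 ∷ Δ 7 11 15 18 19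
      ∷ Δ 9 13 16 18 19 ∷ Δ 0 1 2 10 13 ∷ Δ 0 1 9 13 16 ∷ Δ 1 8 9 16 18 ∷ Δ 1 9 13 16 18
      ∷ Δ 2 7 9 15 19 ∷ Δ 2 7 12 15 19 ∷ Δ 2 7 10 12 19 ∷ Δ 4 7 11 14 18 ∷ Δ 1 4 7 11 18
      ∷ Δ 1 7 10 11 18 ∷ []
  ; cycle =
        Δ 1 2 7 10 13 ∷ Δ 1 7 10 13 18 ∷ Δ 1 7 9 13 18 ∷ Δ 7 9 13 18 19 ∷ Δ 2 7 9 13 19
      ∷ Δ 2 7 10 13 19 ∷ []
  }

curve₇ : Curve
curve₇ = record
  { heights = 6 ∷ 4 ∷ 2 ∷ 2 ∷ 8 ∷ 7 ∷ 8 ∷ 3 ∷ 7 ∷ 5 ∷ 6 ∷ 2 ∷ 1 ∷ 3 ∷ 5 ∷ 5 ∷ 4 ∷ 3 ∷ 0 ∷ 0 ∷ []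
  ; rest =
        Δ 0 1 2 3 11 ∷ Δ 1 2 3 7 18 ∷ Δ 1 3 4 7 18 ∷ Δ 2 3 7 9 19 ∷ Δ 2 5 7 9 19
      ∷ Δ 3 4 7 8 18 ∷ Δ 3 6 7 8 18 ∷ Δ 3 6 7 9 18 ∷ Δ 3 10 11 12 13 ∷ Δ 3 11 12 13 18
      ∷ Δ 3 12 13 18 19 ∷ Δ 3 13 16 18 19 ∷ Δ 7 11 12 17 18 ∷ Δ 7 11 14 17 18 ∷ Δ 7 12 15 17 19
      ∷ Δ 7 12 17 18 19 ∷ Δ 0 3 10 11 12 ∷ Δ 0 2 3 11 12 ∷ Δ 1 4 7 14 18 ∷ Δ 1 7 11 14 18
      ∷ Δ 2 5 7 15 19 ∷ Δ 2 7 12 15 19 ∷ Δ 3 6 16 18 19 ∷ Δ 3 6 9 18 19 ∷ Δ 3 7 9 18 19 ∷ []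
  ; cycle =
        Δ 1 2 3 11 18 ∷ Δ 1 2 7 11 18 ∷ Δ 2 7 11 12 18 ∷ Δ 2 7 12 18 19 ∷ Δ 2 3 7 18 19
      ∷ Δ 2 3 12 18 19 ∷ Δ 2 3 11 12 18 ∷ []
  }

curve₈ : Curve
curve₈ = record
  { heights = 6 ∷ 2 ∷ 2 ∷ 4 ∷ 4 ∷ 4 ∷ 5 ∷ 0 ∷ 2 ∷ 1 ∷ 6 ∷ 4 ∷ 3 ∷ 3 ∷ 8 ∷ 7 ∷ 6 ∷ 5 ∷ 5 ∷ 3 ∷ []
  ; rest =
        Δ 0 1 2 3 13 ∷ Δ 1 2 3 9 13 ∷ Δ 1 2 7 9 13 ∷ Δ 1 3 8 9 13 ∷ Δ 1 4 7 8 11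
      ∷ Δ 1 7 8 9 13 ∷ Δ 1 10 11 12 13 ∷ Δ 2 5 7 9 12 ∷ Δ 3 6 8 9 13 ∷ Δ 7 11 12 13 19
      ∷ Δ 7 11 12 17 19 ∷ Δ 7 11 13 18 19 ∷ Δ 7 11 14 17 18 ∷ Δ 7 11 17 18 19 ∷ Δ 7 12 15 17 19
      ∷ Δ 8 13 16 18 19 ∷ Δ 0 1 2 10 13 ∷ Δ 1 2 10 12 13 ∷ Δ 4 7 11 14 18 ∷ Δ 4 7 8 11 18
      ∷ Δ 5 7 12 15 19 ∷ Δ 5 7 9 12 19 ∷ Δ 6 8 9 13 16 ∷ Δ 8 9 13 16 19 ∷ []
  ; cycle =
        Δ 1 2 7 12 13 ∷ Δ 1 7 11 12 13 ∷ Δ 1 7 8 11 13 ∷ Δ 7 8 11 13 18 ∷ Δ 7 8 13 18 19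
      ∷ Δ 7 8 9 13 19 ∷ Δ 7 9 12 13 19 ∷ Δ 2 7 9 12 13 ∷ []
  }

curve₉ : Curve
curve₉ = record
  { heights = 8 ∷ 5 ∷ 6 ∷ 7 ∷ 6 ∷ 10 ∷ 11 ∷ 6 ∷ 7 ∷ 6 ∷ 9 ∷ 7 ∷ 2 ∷ 4 ∷ 11 ∷ 7 ∷ 6 ∷ 5 ∷ 3 ∷ 0 ∷ []
  ; rest =
        Δ 0 1 2 3 19 ∷ Δ 1 2 3 9 19 ∷ Δ 1 2 7 9 19 ∷ Δ 1 3 8 9 19 ∷ Δ 1 4 7 9 19
      ∷ Δ 1 4 8 9 19 ∷ Δ 1 10 11 12 13 ∷ Δ 1 11 12 13 18 ∷ Δ 1 12 13 18 19 ∷ Δ 2 5 7 9 19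
      ∷ Δ 3 6 8 9 19 ∷ Δ 3 13 16 18 19 ∷ Δ 4 11 12 17 18 ∷ Δ 4 11 14 17 18 ∷ Δ 4 12 17 18 19
      ∷ Δ 7 12 15 17 19 ∷ Δ 0 1 10 12 13 ∷ Δ 1 4 11 12 18 ∷ Δ 3 6 8 16 19 ∷ Δ 3 8 16 18 19
      ∷ Δ 4 7 12 17 19 ∷ Δ 5 7 12 15 19 ∷ Δ 2 5 7 12 19 ∷ []
  ; cycle =
        Δ 0 1 2 12 19 ∷ Δ 0 1 12 13 19 ∷ Δ 0 1 3 13 19 ∷ Δ 1 3 13 18 19 ∷ Δ 1 3 8 18 19
      ∷ Δ 1 4 8 18 19 ∷ Δ 1 4 12 18 19 ∷ Δ 1 4 7 12 19 ∷ Δ 1 2 7 12 19 ∷ []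
  }

curve₁₀ : Curve
curve₁₀ = record
  { heights = 8 ∷ 3 ∷ 6 ∷ 7 ∷ 5 ∷ 11 ∷ 12 ∷ 0 ∷ 5 ∷ 6 ∷ 8 ∷ 6 ∷ 4 ∷ 3 ∷ 11 ∷ 5 ∷ 4 ∷ 1 ∷ 3 ∷ 3 ∷ []
  ; rest =
        Δ 0 1 3 7 13 ∷ Δ 0 2 3 7 13 ∷ Δ 1 3 7 8 16 ∷ Δ 1 4 7 8 18 ∷ Δ 1 10 11 13 17
      ∷ Δ 1 10 12 13 17 ∷ Δ 1 11 13 17 18 ∷ Δ 2 3 7 9 13 ∷ Δ 2 5 7 9 15 ∷ Δ 3 6 8 9 16
      ∷ Δ 3 7 8 9 16 ∷ Δ 4 11 14 17 18 ∷ Δ 7 12 13 17 19 ∷ Δ 7 12 15 17 19 ∷ Δ 7 13 16 17 18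
      ∷ Δ 7 13 16 17 19 ∷ Δ 0 1 10 12 13 ∷ Δ 1 4 11 17 18 ∷ Δ 1 4 7 17 18 ∷ Δ 1 7 8 16 18
      ∷ Δ 2 7 9 15 19 ∷ Δ 2 7 12 15 19 ∷ []
  ; cycle =
        Δ 0 1 7 12 13 ∷ Δ 0 2 7 12 13 ∷ Δ 2 7 12 13 19 ∷ Δ 2 7 9 13 19 ∷ Δ 7 9 13 16 19
      ∷ Δ 3 7 9 13 16 ∷ Δ 1 3 7 13 16 ∷ Δ 1 7 13 16 18 ∷ Δ 1 7 13 17 18 ∷ Δ 1 7 12 13 17 ∷ []
  }

curve₁₁ : Curve
curve₁₁ = record
  { heights = 9 ∷ 2 ∷ 4 ∷ 5 ∷ 7 ∷ 7 ∷ 10 ∷ 0 ∷ 4 ∷ 1 ∷ 9 ∷ 10 ∷ 8 ∷ 3 ∷ 13 ∷ 12 ∷ 9 ∷ 7 ∷ 9 ∷ 4 ∷ []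
  ; rest =
        Δ 0 1 2 3 13 ∷ Δ 1 2 3 9 13 ∷ Δ 1 2 7 9 13 ∷ Δ 1 3 8 9 13 ∷ Δ 1 4 7 8 13
      ∷ Δ 1 7 8 9 13 ∷ Δ 1 10 11 13 17 ∷ Δ 1 11 13 14 17 ∷ Δ 2 5 7 9 19 ∷ Δ 3 6 8 9 13
      ∷ Δ 7 10 12 13 17 ∷ Δ 7 12 13 17 19 ∷ Δ 7 12 15 17 19 ∷ Δ 7 13 14 17 18 ∷ Δ 7 13 17 18 19
      ∷ Δ 8 13 16 18 19 ∷ Δ 0 1 2 10 13 ∷ Δ 5 7 12 15 19 ∷ Δ 2 5 7 12 19 ∷ Δ 6 8 9 13 16
      ∷ Δ 8 9 13 16 19 ∷ []
  ; cycle =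
        Δ 1 2 7 10 13 ∷ Δ 1 7 10 13 17 ∷ Δ 1 7 13 14 17 ∷ Δ 1 4 7 13 14 ∷ Δ 4 7 13 14 18
      ∷ Δ 4 7 8 13 18 ∷ Δ 7 8 13 18 19 ∷ Δ 7 8 9 13 19 ∷ Δ 2 7 9 13 19 ∷ Δ 2 7 12 13 19
      ∷ Δ 2 7 10 12 13 ∷ []
  }

curve₁₂ : Curve
curve₁₂ = record
  { heights = 9 ∷ 8 ∷ 5 ∷ 6 ∷ 8 ∷ 7 ∷ 12 ∷ 0 ∷ 8 ∷ 6 ∷ 10 ∷ 8 ∷ 7 ∷ 5 ∷ 11 ∷ 12 ∷ 7 ∷ 9 ∷ 6 ∷ 6 ∷ []
  ; rest =
        Δ 0 1 3 7 13 ∷ Δ 0 2 3 7 13 ∷ Δ 1 3 4 7 13 ∷ Δ 2 3 7 9 13 ∷ Δ 2 5 7 9 19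
      ∷ Δ 3 4 7 8 18 ∷ Δ 3 6 7 8 16 ∷ Δ 3 6 7 9 16 ∷ Δ 7 10 11 12 13 ∷ Δ 7 11 12 13 18
      ∷ Δ 7 11 12 17 18 ∷ Δ 7 11 14 17 18 ∷ Δ 7 12 13 18 19 ∷ Δ 7 12 15 17 19 ∷ Δ 7 12 17 18 19
      ∷ Δ 7 13 16 18 19 ∷ Δ 3 7 8 16 18 ∷ Δ 4 7 11 14 18 ∷ Δ 5 7 12 15 19 ∷ Δ 2 5 7 12 19 ∷ []
  ; cycle =
        Δ 0 1 7 11 13 ∷ Δ 0 7 10 11 13 ∷ Δ 0 2 7 10 13 ∷ Δ 2 7 10 12 13 ∷ Δ 2 7 12 13 19
      ∷ Δ 2 7 9 13 19 ∷ Δ 7 9 13 16 19 ∷ Δ 3 7 9 13 16 ∷ Δ 3 7 13 16 18 ∷ Δ 3 4 7 13 18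
      ∷ Δ 4 7 11 13 18 ∷ Δ 1 4 7 11 13 ∷ []
  }

curve₁₃ : Curve
curve₁₃ = record
  { heights = 8 ∷ 4 ∷ 6 ∷ 7 ∷ 7 ∷ 8 ∷ 7 ∷ 4 ∷ 5 ∷ 3 ∷ 8 ∷ 7 ∷ 4 ∷ 5 ∷ 9 ∷ 8 ∷ 9 ∷ 5 ∷ 5 ∷ 0 ∷ []
  ; rest =
        Δ 0 1 2 9 19 ∷ Δ 0 1 3 9 19 ∷ Δ 1 2 7 9 19 ∷ Δ 1 3 6 9 19 ∷ Δ 1 4 7 8 19
      ∷ Δ 1 6 8 9 19 ∷ Δ 1 7 8 9 19 ∷ Δ 1 10 11 12 19 ∷ Δ 1 10 11 13 19 ∷ Δ 1 11 12 17 19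
      ∷ Δ 1 11 13 18 19 ∷ Δ 1 11 14 17 19 ∷ Δ 1 11 14 18 19 ∷ Δ 2 5 7 9 19 ∷ Δ 6 13 16 18 19
      ∷ Δ 7 12 15 17 19 ∷ Δ 5 7 12 15 19 ∷ Δ 2 5 7 12 19 ∷ Δ 6 8 13 18 19 ∷ []
  ; cycle =
        Δ 0 1 2 12 19 ∷ Δ 0 1 10 12 19 ∷ Δ 0 1 10 13 19 ∷ Δ 0 1 3 13 19 ∷ Δ 1 3 6 13 19
      ∷ Δ 1 6 8 13 19 ∷ Δ 1 8 13 18 19 ∷ Δ 1 4 8 18 19 ∷ Δ 1 4 14 18 19 ∷ Δ 1 4 14 17 19
      ∷ Δ 1 4 7 17 19 ∷ Δ 1 7 12 17 19 ∷ Δ 1 2 7 12 19 ∷ []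
  }

curve₁₄ : Curve
curve₁₄ = record
  { heights = 9 ∷ 2 ∷ 6 ∷ 4 ∷ 7 ∷ 5 ∷ 13 ∷ 4 ∷ 4 ∷ 0 ∷ 9 ∷ 9 ∷ 4 ∷ 6 ∷ 11 ∷ 12 ∷ 5 ∷ 7 ∷ 7 ∷ 0 ∷ []
  ; rest =
        Δ 0 1 2 9 12 ∷ Δ 0 1 3 9 12 ∷ Δ 1 2 5 9 12 ∷ Δ 1 3 8 9 16 ∷ Δ 1 4 7 9 19
      ∷ Δ 1 4 8 9 19 ∷ Δ 1 5 7 9 19 ∷ Δ 1 10 11 12 19 ∷ Δ 1 10 11 13 19 ∷ Δ 1 11 12 14 19
      ∷ Δ 1 11 13 18 19 ∷ Δ 1 11 14 18 19 ∷ Δ 1 12 14 17 19 ∷ Δ 1 13 16 18 19 ∷ Δ 3 6 8 9 16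
      ∷ Δ 5 12 15 17 19 ∷ Δ 0 1 3 10 12 ∷ Δ 5 7 12 17 19 ∷ []
  ; cycle =
        Δ 1 3 9 12 19 ∷ Δ 1 3 10 12 19 ∷ Δ 1 3 10 13 19 ∷ Δ 1 3 13 16 19 ∷ Δ 1 3 9 16 19
      ∷ Δ 1 8 9 16 19 ∷ Δ 1 8 16 18 19 ∷ Δ 1 4 8 18 19 ∷ Δ 1 4 14 18 19 ∷ Δ 1 4 14 17 19
      ∷ Δ 1 4 7 17 19 ∷ Δ 1 7 12 17 19 ∷ Δ 1 5 7 12 19 ∷ Δ 1 5 9 12 19 ∷ []
  }

curve₁₅ : Curve
curve₁₅ = record
  { heights = 17 ∷ 20 ∷ 17 ∷ 19 ∷ 28 ∷ 25 ∷ 26 ∷ 22 ∷ 20 ∷ 25 ∷ 17 ∷ 5 ∷ 9 ∷ 6 ∷ 6 ∷ 10 ∷ 7 ∷ 4 ∷ 0 ∷ 8 ∷ []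
  ; rest =
        Δ 0 1 2 8 18 ∷ Δ 0 2 3 8 18 ∷ Δ 0 10 11 12 13 ∷ Δ 0 11 12 13 18 ∷ Δ 0 11 12 17 18
      ∷ Δ 0 11 14 17 18 ∷ Δ 1 2 7 8 18 ∷ Δ 1 4 7 8 14 ∷ Δ 2 3 6 8 18 ∷ Δ 2 5 7 8 18
      ∷ Δ 2 5 8 9 18 ∷ Δ 2 6 8 9 18 ∷ Δ 2 12 13 15 18 ∷ Δ 2 12 15 17 18 ∷ Δ 2 13 15 18 19
      ∷ Δ 2 13 16 18 19 ∷ Δ 1 7 8 14 18 ∷ []
  ; cycle =
        Δ 0 1 2 14 18 ∷ Δ 0 2 14 17 18 ∷ Δ 0 2 12 17 18 ∷ Δ 0 2 12 13 18 ∷ Δ 0 2 13 16 18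
      ∷ Δ 0 2 3 16 18 ∷ Δ 2 3 6 16 18 ∷ Δ 2 6 9 16 18 ∷ Δ 2 5 9 16 18 ∷ Δ 2 5 16 18 19
      ∷ Δ 2 5 15 18 19 ∷ Δ 2 5 15 17 18 ∷ Δ 2 5 7 17 18 ∷ Δ 2 7 14 17 18 ∷ Δ 1 2 7 14 18 ∷ []
  }

curve₁₆ : Curve
curve₁₆ = record
  { heights = 8 ∷ 9 ∷ 5 ∷ 8 ∷ 13 ∷ 11 ∷ 11 ∷ 10 ∷ 10 ∷ 9 ∷ 9 ∷ 5 ∷ 7 ∷ 5 ∷ 4 ∷ 7 ∷ 7 ∷ 4 ∷ 0 ∷ 6 ∷ []
  ; rest =
        Δ 0 1 2 3 18 ∷ Δ 1 2 3 8 18 ∷ Δ 1 2 4 8 18 ∷ Δ 2 3 6 8 18 ∷ Δ 2 4 7 8 18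
      ∷ Δ 2 5 7 9 18 ∷ Δ 2 6 8 9 18 ∷ Δ 2 7 8 9 18 ∷ Δ 2 10 11 12 18 ∷ Δ 2 10 12 13 18
      ∷ Δ 2 11 12 17 18 ∷ Δ 2 11 14 17 18 ∷ Δ 2 12 13 15 18 ∷ Δ 2 12 15 17 18 ∷ Δ 2 13 15 18 19
      ∷ Δ 2 13 16 18 19 ∷ []
  ; cycle =
        Δ 0 1 2 14 18 ∷ Δ 0 2 11 14 18 ∷ Δ 0 2 10 11 18 ∷ Δ 0 2 10 13 18 ∷ Δ 0 2 3 13 18
      ∷ Δ 2 3 13 16 18 ∷ Δ 2 3 6 16 18 ∷ Δ 2 6 9 16 18 ∷ Δ 2 9 16 18 19 ∷ Δ 2 9 15 18 19
      ∷ Δ 2 5 9 15 18 ∷ Δ 2 5 15 17 18 ∷ Δ 2 5 7 17 18 ∷ Δ 2 7 14 17 18 ∷ Δ 2 4 7 14 18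
      ∷ Δ 1 2 4 14 18 ∷ []
  }

-- Verification of the fourteen curves

curves : Vec Curve 14
curves = curve₃ ∷ curve₄ ∷ curve₅ ∷ curve₆ ∷ curve₇ ∷ curve₈ ∷ curve₉ ∷ curve₁₀ ∷ curve₁₁
       ∷ curve₁₂ ∷ curve₁₃ ∷ curve₁₄ ∷ curve₁₅ ∷ curve₁₆ ∷ []

certified : ∀ k → Certified (lookup curves k)
certified = decided (Fin.all? λ k → certified? (lookup curves k)) refl

cycleLength : ∀ k → length (Curve.cycle (lookup curves k)) ≡ 3 ℕ.+ toℕ k
cycleLength = decided (Fin.all? λ k → length (Curve.cycle (lookup curves k)) ℕ.≟ 3 ℕ.+ toℕ k) refl

corollary4p5 : ∀ (n : ℕ) → 3 ≤ n → n ≤ 16 →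
    ∃[ T ] IsTriangulation T × IsRegular T × IsUnimodular T × UniqueCycleHasLength (G T) n
corollary4p5 n 3≤n n≤16 =
  Curve.cells 𝒞 ,
  subst (λ m → IsTriangulation cells × IsRegular cells × IsUnimodular cells ×
               UniqueCycleHasLength (G cells) m)
    length≡n (certified⇒corollary 𝒞 (certified k))
  where
  -- The lengths in `curves` begin at 3, so the curve for `n` has index `n ∸ 3`, at most 13.
  k<14 : n ℕ.∸ 3 ℕ.< 14
  k<14 = s≤s (ℕ.∸-monoˡ-≤ 3 n≤16)

  k : Fin 14
  k = fromℕ< k<14

  𝒞 : Curve
  𝒞 = lookup curves k

  open Curve 𝒞 using (cells)

  length≡n : length (Curve.cycle 𝒞) ≡ n
  length≡n = trans (cycleLength k) (trans (cong (3 ℕ.+_) (Fin.toℕ-fromℕ< k<14)) (ℕ.m+[n∸m]≡n 3≤n))
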